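{- For any $\alpha>0$, integers $n>0$, $m>2$ with $m>n$, and $k$ with $n\le k\le m$, there exists a full rank matrix $X\in\mathbb{R}^{n\times m}$ such that for every subset $\mathcal S\subseteq[m]$ of cardinality $k$ with $\mathrm{rank}(X_{\mathcal S})=n$, $$\|X_{\mathcal S}^{\dagger}\|_2^2\ge\Big(\frac{m+\alpha^2}{k+\alpha^2}-1\Big)\|X^{\dagger}\|_2^2 .$$
   Context: $[m]=\{1,\dots,m\}$; $X_{\mathcal S}$ is the submatrix of columns of $X$ indexed by $\mathcal S$; $A^\dagger$ is the Moore–Penrose pseudo-inverse; $\|\cdot\|_2$ is the spectral norm. -}

module Defs where

open import Algebra.Bundles using (RawMonoid)
import Algebra.Definitions.RawMonoid as RawMonoidDefs
open import Data.Bool.Base using (true; false)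
open import Data.Fin.Base using (Fin; zero; suc)
open import Data.Fin.Subset using (Subset; ∣_∣)
open import Data.Integer.Base using (+_)
open import Data.Nat.Base as ℕ using (ℕ)
import Data.Nat.Properties as ℕ
open import Data.Product.Base using (Σ; ∃; _×_; _,_; proj₁; proj₂)
open import Data.Rational.Base as ℚ using (ℚ; 0ℚ; 1ℚ; ½)
import Data.Rational.Properties as ℚ
open import Data.Rational.Solver using (module +-*-Solver)
open import Data.Vec.Base using ([]; _∷_)
open import Data.Vec.Functional using (Vector; transpose)
open import Level using (0ℓ)
open import Relation.Binary.PropositionalEquality
  using (_≡_; refl; sym; trans; cong; cong₂; subst; subst₂)
open import Relation.Nullary using (yes; no; contradiction)

open ℚ.≤-Reasoning
open +-*-Solver using (solve; _:+_; _:*_; :-_; _:-_; _:=_; con)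

------------------------------------------------------------------------
-- Rational estimates

private
  *-mono-≤ : ∀ {a b c d} → 0ℚ ℚ.≤ b → 0ℚ ℚ.≤ c → a ℚ.≤ b → c ℚ.≤ d →
             a ℚ.* c ℚ.≤ b ℚ.* d
  *-mono-≤ {a} {b} {c} {d} 0≤b 0≤c a≤b c≤d = ℚ.≤-trans
    (ℚ.*-monoʳ-≤-nonNeg c {{ℚ.nonNegative 0≤c}} a≤b)
    (ℚ.*-monoˡ-≤-nonNeg b {{ℚ.nonNegative 0≤b}} c≤d)

  0<*0< : ∀ {a b} → 0ℚ ℚ.< a → 0ℚ ℚ.< b → 0ℚ ℚ.< a ℚ.* b
  0<*0< {a} {b} 0<a 0<b = ℚ.positive⁻¹ (a ℚ.* b)
    {{ℚ.pos*pos⇒pos a {{ℚ.positive 0<a}} b {{ℚ.positive 0<b}}}}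

  split : ∀ ε → 0ℚ ℚ.< ε → ∃ λ δ → 0ℚ ℚ.< δ × δ ℚ.+ δ ≡ ε
  split ε 0<ε = ½ ℚ.* ε , 0<*0< {½} {ε} (ℚ.positive⁻¹ ½) 0<ε
              , trans (sym (ℚ.*-distribʳ-+ ε ½ ½)) (ℚ.*-identityˡ ε)

-- Total inverse on ℚ, with the junk value 0 at 0.
inv : ℚ → ℚ
inv q with q ℚ.≟ 0ℚ
... | yes _  = 0ℚ
... | no q≢0 = (ℚ.1/ q) {{ℚ.≢-nonZero q≢0}}

private
  *-inv : ∀ {q} → 0ℚ ℚ.< q → q ℚ.* inv q ≡ 1ℚ
  *-inv {q} 0<q with q ℚ.≟ 0ℚ
  ... | yes q≡0 = contradiction (sym q≡0) (ℚ.<⇒≢ 0<q)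
  ... | no q≢0  = ℚ.*-inverseʳ q {{ℚ.≢-nonZero q≢0}}

  0<inv : ∀ {q} → 0ℚ ℚ.< q → 0ℚ ℚ.< inv q
  0<inv {q} 0<q with q ℚ.≟ 0ℚ
  ... | yes q≡0 = contradiction (sym q≡0) (ℚ.<⇒≢ 0<q)
  ... | no q≢0  = ℚ.positive⁻¹ _ {{ℚ.1/pos⇒pos q {{ℚ.positive 0<q}}}}

  inv-anti : ∀ {a b} → 0ℚ ℚ.< a → a ℚ.≤ b → inv b ℚ.≤ inv a
  inv-anti {a} {b} 0<a a≤b = begin
    inv b                        ≡⟨ sym (ℚ.*-identityˡ (inv b)) ⟩
    1ℚ ℚ.* inv b                 ≡⟨ cong (ℚ._* inv b) (sym (*-inv 0<a)) ⟩
    a ℚ.* inv a ℚ.* inv b        ≤⟨ ℚ.*-monoʳ-≤-nonNeg (inv b) {{≥0 0<ib}}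
                                      (ℚ.*-monoʳ-≤-nonNeg (inv a) {{≥0 (0<inv 0<a)}} a≤b) ⟩
    b ℚ.* inv a ℚ.* inv b        ≡⟨ solve 3 (λ x y z → x :* y :* z := x :* z :* y)
                                      refl b (inv a) (inv b) ⟩
    b ℚ.* inv b ℚ.* inv a        ≡⟨ cong (ℚ._* inv a) (*-inv 0<b) ⟩
    1ℚ ℚ.* inv a                 ≡⟨ ℚ.*-identityˡ (inv a) ⟩
    inv a                        ∎
    where
    0<b : 0ℚ ℚ.< b
    0<b = ℚ.<-≤-trans 0<a a≤b
    0<ib : 0ℚ ℚ.< inv b
    0<ib = 0<inv 0<b
    ≥0 : ∀ {q} → 0ℚ ℚ.< q → ℚ.NonNegative q
    ≥0 0<q = ℚ.nonNegative (ℚ.<⇒≤ 0<q)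

------------------------------------------------------------------------
-- Real numbers: Cauchy sequences of rationals, with setoid equality _≈_

Cauchy : (ℕ → ℚ) → Set
Cauchy s = ∀ ε → 0ℚ ℚ.< ε →
  ∃ λ N → ∀ i j → N ℕ.≤ i → N ℕ.≤ j → ℚ.∣ s i ℚ.- s j ∣ ℚ.≤ ε

record ℝ : Set where
  constructor mkℝ
  field
    seq    : ℕ → ℚ
    cauchy : Cauchy seq

open ℝ public

Eventually : (ℕ → Set) → Set
Eventually P = ∃ λ N → ∀ n → N ℕ.≤ n → P n

infix 4 _≈_ _≤_ _<_ _≥_

_≈_ _≤_ _<_ _≥_ : ℝ → ℝ → Set
x ≈ y = ∀ ε → 0ℚ ℚ.< ε → Eventually λ n → ℚ.∣ seq x n ℚ.- seq y n ∣ ℚ.≤ ε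
x ≤ y = ∀ ε → 0ℚ ℚ.< ε → Eventually λ n → seq x n ℚ.≤ seq y n ℚ.+ ε
x < y = ∃ λ ε → 0ℚ ℚ.< ε × Eventually λ n → seq x n ℚ.+ ε ℚ.≤ seq y n
x ≥ y = y ≤ x

fromℚ : ℚ → ℝ
fromℚ q = mkℝ (λ _ → q) λ ε 0<ε → 0 , λ _ _ _ _ →
  subst (ℚ._≤ ε) (cong ℚ.∣_∣ (sym (ℚ.+-inverseʳ q))) (ℚ.<⇒≤ 0<ε)

fromℕ : ℕ → ℝ
fromℕ n = fromℚ (+ n ℚ./ 1)

0ℝ 1ℝ : ℝ
0ℝ = fromℚ 0ℚ
1ℝ = fromℚ 1ℚ

private
  +-cauchy : ∀ x y → Cauchy (λ n → seq x n ℚ.+ seq y n)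
  +-cauchy x y ε 0<ε with split ε 0<ε
  ... | δ , 0<δ , δ+δ≡ε with cauchy x δ 0<δ | cauchy y δ 0<δ
  ... | M , hM | N , hN = M ℕ.⊔ N , λ i j p q → begin
    ℚ.∣ (seq x i ℚ.+ seq y i) ℚ.- (seq x j ℚ.+ seq y j) ∣
      ≡⟨ cong ℚ.∣_∣ (solve 4 (λ a b c d → (a :+ b) :- (c :+ d) := (a :- c) :+ (b :- d))
           refl (seq x i) (seq y i) (seq x j) (seq y j)) ⟩
    ℚ.∣ (seq x i ℚ.- seq x j) ℚ.+ (seq y i ℚ.- seq y j) ∣
      ≤⟨ ℚ.∣p+q∣≤∣p∣+∣q∣ (seq x i ℚ.- seq x j) (seq y i ℚ.- seq y j) ⟩
    ℚ.∣ seq x i ℚ.- seq x j ∣ ℚ.+ ℚ.∣ seq y i ℚ.- seq y j ∣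
      ≤⟨ ℚ.+-mono-≤ (hM i j (ℕ.m⊔n≤o⇒m≤o M N p) (ℕ.m⊔n≤o⇒m≤o M N q))
                    (hN i j (ℕ.m⊔n≤o⇒n≤o M N p) (ℕ.m⊔n≤o⇒n≤o M N q)) ⟩
    δ ℚ.+ δ
      ≡⟨ δ+δ≡ε ⟩
    ε ∎

  neg-cauchy : ∀ x → Cauchy (λ n → ℚ.- seq x n)
  neg-cauchy x ε 0<ε with cauchy x ε 0<ε
  ... | N , h = N , λ i j p q → begin
    ℚ.∣ ℚ.- seq x i ℚ.- ℚ.- seq x j ∣
      ≡⟨ cong ℚ.∣_∣ (solve 2 (λ a b → :- a :- :- b := b :- a) refl (seq x i) (seq x j)) ⟩
    ℚ.∣ seq x j ℚ.- seq x i ∣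
      ≤⟨ h j i q p ⟩
    ε ∎

  bounded : ∀ x → ∃ λ B → 0ℚ ℚ.< B × Eventually λ n → ℚ.∣ seq x n ∣ ℚ.≤ B
  bounded x with cauchy x 1ℚ (ℚ.positive⁻¹ 1ℚ)
  ... | N , h = 1ℚ ℚ.+ ℚ.∣ seq x N ∣
              , ℚ.+-mono-<-≤ (ℚ.positive⁻¹ 1ℚ) (ℚ.0≤∣p∣ (seq x N))
              , N , λ n N≤n → begin
    ℚ.∣ seq x n ∣
      ≡⟨ cong ℚ.∣_∣ (solve 2 (λ a b → a := (a :- b) :+ b) refl (seq x n) (seq x N)) ⟩
    ℚ.∣ (seq x n ℚ.- seq x N) ℚ.+ seq x N ∣
      ≤⟨ ℚ.∣p+q∣≤∣p∣+∣q∣ (seq x n ℚ.- seq x N) (seq x N) ⟩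
    ℚ.∣ seq x n ℚ.- seq x N ∣ ℚ.+ ℚ.∣ seq x N ∣
      ≤⟨ ℚ.+-monoˡ-≤ ℚ.∣ seq x N ∣ (h n N N≤n ℕ.≤-refl) ⟩
    1ℚ ℚ.+ ℚ.∣ seq x N ∣ ∎

  cancel : ∀ {C} → 0ℚ ℚ.< C → ∀ ε → C ℚ.* (ε ℚ.* inv C) ≡ ε
  cancel {C} 0<C ε = trans
    (solve 3 (λ c e d → c :* (e :* d) := e :* (c :* d)) refl C ε (inv C))
    (trans (cong (ε ℚ.*_) (*-inv 0<C)) (ℚ.*-identityʳ ε))

  *-estimate : ∀ a b c d {A B ε} → 0ℚ ℚ.< A → 0ℚ ℚ.< B →
    ℚ.∣ a ∣ ℚ.≤ A → ℚ.∣ d ∣ ℚ.≤ B →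
    ℚ.∣ b ℚ.- d ∣ ℚ.≤ ε ℚ.* inv A → ℚ.∣ a ℚ.- c ∣ ℚ.≤ ε ℚ.* inv B →
    ℚ.∣ a ℚ.* b ℚ.- c ℚ.* d ∣ ℚ.≤ ε ℚ.+ ε
  *-estimate a b c d {A} {B} {ε} 0<A 0<B a≤A d≤B b-d≤ a-c≤ = begin
    ℚ.∣ a ℚ.* b ℚ.- c ℚ.* d ∣
      ≡⟨ cong ℚ.∣_∣ (solve 4 (λ a b c d → a :* b :- c :* d := a :* (b :- d) :+ d :* (a :- c))
           refl a b c d) ⟩
    ℚ.∣ a ℚ.* (b ℚ.- d) ℚ.+ d ℚ.* (a ℚ.- c) ∣
      ≤⟨ ℚ.∣p+q∣≤∣p∣+∣q∣ (a ℚ.* (b ℚ.- d)) (d ℚ.* (a ℚ.- c)) ⟩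
    ℚ.∣ a ℚ.* (b ℚ.- d) ∣ ℚ.+ ℚ.∣ d ℚ.* (a ℚ.- c) ∣
      ≡⟨ cong₂ ℚ._+_ (ℚ.∣p*q∣≡∣p∣*∣q∣ a (b ℚ.- d)) (ℚ.∣p*q∣≡∣p∣*∣q∣ d (a ℚ.- c)) ⟩
    ℚ.∣ a ∣ ℚ.* ℚ.∣ b ℚ.- d ∣ ℚ.+ ℚ.∣ d ∣ ℚ.* ℚ.∣ a ℚ.- c ∣
      ≤⟨ ℚ.+-mono-≤
           (*-mono-≤ (ℚ.<⇒≤ 0<A) (ℚ.0≤∣p∣ (b ℚ.- d)) a≤A b-d≤)
           (*-mono-≤ (ℚ.<⇒≤ 0<B) (ℚ.0≤∣p∣ (a ℚ.- c)) d≤B a-c≤) ⟩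
    A ℚ.* (ε ℚ.* inv A) ℚ.+ B ℚ.* (ε ℚ.* inv B)
      ≡⟨ cong₂ ℚ._+_ (cancel 0<A ε) (cancel 0<B ε) ⟩
    ε ℚ.+ ε ∎

  cauchy-scaled : ∀ x {ε B} → 0ℚ ℚ.< ε → 0ℚ ℚ.< B → ∃ λ N → ∀ i j →
    N ℕ.≤ i → N ℕ.≤ j → ℚ.∣ seq x i ℚ.- seq x j ∣ ℚ.≤ ε ℚ.* inv B
  cauchy-scaled x {ε} {B} 0<ε 0<B = cauchy x (ε ℚ.* inv B) (0<*0< {ε} {inv B} 0<ε (0<inv 0<B))

  *-cauchy : ∀ x y → Cauchy (λ n → seq x n ℚ.* seq y n)
  *-cauchy x y ε 0<ε =
    let A , 0<A , K , hK = bounded x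
        B , 0<B , L , hL = bounded y
        δ , 0<δ , δ+δ≡ε  = split ε 0<ε
        M , hM           = cauchy-scaled x {δ} {B} 0<δ 0<B
        N , hN           = cauchy-scaled y {δ} {A} 0<δ 0<A
        KL≤ : ∀ {i} → (K ℕ.⊔ L) ℕ.⊔ (M ℕ.⊔ N) ℕ.≤ i → K ℕ.⊔ L ℕ.≤ i
        KL≤ = ℕ.m⊔n≤o⇒m≤o (K ℕ.⊔ L) (M ℕ.⊔ N)
        MN≤ : ∀ {i} → (K ℕ.⊔ L) ℕ.⊔ (M ℕ.⊔ N) ℕ.≤ i → M ℕ.⊔ N ℕ.≤ i
        MN≤ = ℕ.m⊔n≤o⇒n≤o (K ℕ.⊔ L) (M ℕ.⊔ N)
    in (K ℕ.⊔ L) ℕ.⊔ (M ℕ.⊔ N) , λ i j p q → ℚ.≤-trans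
      (*-estimate (seq x i) (seq y i) (seq x j) (seq y j) {A} {B} {δ} 0<A 0<B
        (hK i (ℕ.m⊔n≤o⇒m≤o K L (KL≤ p))) (hL j (ℕ.m⊔n≤o⇒n≤o K L (KL≤ q)))
        (hN i j (ℕ.m⊔n≤o⇒n≤o M N (MN≤ p)) (ℕ.m⊔n≤o⇒n≤o M N (MN≤ q)))
        (hM i j (ℕ.m⊔n≤o⇒m≤o M N (MN≤ p)) (ℕ.m⊔n≤o⇒m≤o M N (MN≤ q))))
      (ℚ.≤-reflexive δ+δ≡ε)

  inv-cauchy : ∀ x → 0ℝ < x → Cauchy (λ n → inv (seq x n))
  inv-cauchy x (c , 0<c , K , hK) ε 0<ε
    with cauchy x (ε ℚ.* (c ℚ.* c)) (0<*0< 0<ε (0<*0< 0<c 0<c))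
  ... | N , hN = K ℕ.⊔ N , λ i j p q → let
      c≤xi = c≤ (ℕ.m⊔n≤o⇒m≤o K N p)
      c≤xj = c≤ (ℕ.m⊔n≤o⇒m≤o K N q)
      0<xi = ℚ.<-≤-trans 0<c c≤xi
      0<xj = ℚ.<-≤-trans 0<c c≤xj
      u = inv (seq x i)
      v = inv (seq x j)
      0≤u = ℚ.<⇒≤ (0<inv 0<xi)
      0≤v = ℚ.<⇒≤ (0<inv 0<xj)
    in begin
    ℚ.∣ u ℚ.- v ∣
      ≡⟨ cong ℚ.∣_∣ (difference 0<xi 0<xj) ⟩
    ℚ.∣ (seq x j ℚ.- seq x i) ℚ.* (u ℚ.* v) ∣
      ≡⟨ ℚ.∣p*q∣≡∣p∣*∣q∣ (seq x j ℚ.- seq x i) (u ℚ.* v) ⟩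
    ℚ.∣ seq x j ℚ.- seq x i ∣ ℚ.* ℚ.∣ u ℚ.* v ∣
      ≡⟨ cong (ℚ.∣ seq x j ℚ.- seq x i ∣ ℚ.*_)
           (ℚ.0≤p⇒∣p∣≡p (ℚ.<⇒≤ (0<*0< (0<inv 0<xi) (0<inv 0<xj)))) ⟩
    ℚ.∣ seq x j ℚ.- seq x i ∣ ℚ.* (u ℚ.* v)
      ≤⟨ *-mono-≤ (ℚ.<⇒≤ (0<*0< 0<ε (0<*0< 0<c 0<c)))
           (ℚ.<⇒≤ (0<*0< (0<inv 0<xi) (0<inv 0<xj)))
           (hN j i (ℕ.m⊔n≤o⇒n≤o K N q) (ℕ.m⊔n≤o⇒n≤o K N p))
           (*-mono-≤ (ℚ.<⇒≤ (0<inv 0<c)) 0≤v (inv-anti 0<c c≤xi) (inv-anti 0<c c≤xj)) ⟩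
    ε ℚ.* (c ℚ.* c) ℚ.* (inv c ℚ.* inv c)
      ≡⟨ solve 3 (λ e a b → e :* (a :* a) :* (b :* b) := e :* ((a :* b) :* (a :* b)))
           refl ε c (inv c) ⟩
    ε ℚ.* ((c ℚ.* inv c) ℚ.* (c ℚ.* inv c))
      ≡⟨ cong (λ t → ε ℚ.* (t ℚ.* t)) (*-inv 0<c) ⟩
    ε ℚ.* 1ℚ
      ≡⟨ ℚ.*-identityʳ ε ⟩
    ε ∎
    where
    c≤ : ∀ {i} → K ℕ.≤ i → c ℚ.≤ seq x i
    c≤ {i} K≤i = subst (ℚ._≤ seq x i) (ℚ.+-identityˡ c) (hK i K≤i)
    difference : ∀ {a b} → 0ℚ ℚ.< a → 0ℚ ℚ.< b →
                 inv a ℚ.- inv b ≡ (b ℚ.- a) ℚ.* (inv a ℚ.* inv b)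
    difference {a} {b} 0<a 0<b = sym (trans
      (solve 4 (λ a b u v → (b :- a) :* (u :* v) := (b :* v) :* u :- (a :* u) :* v)
        refl a b (inv a) (inv b))
      (cong₂ ℚ._-_
        (trans (cong (ℚ._* inv a) (*-inv 0<b)) (ℚ.*-identityˡ (inv a)))
        (trans (cong (ℚ._* inv b) (*-inv 0<a)) (ℚ.*-identityˡ (inv b)))))

infixl 6 _+_ _-_
infixl 7 _*_
infix  8 -_ _²
infixl 7 _/_[_]

-- Opaque, since otherwise Agda may unfold real arithmetic down to gcds in ℚ.
opaque
  _+_ _*_ : ℝ → ℝ → ℝ
  x + y = mkℝ (λ n → seq x n ℚ.+ seq y n) (+-cauchy x y)
  x * y = mkℝ (λ n → seq x n ℚ.* seq y n) (*-cauchy x y)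

  -_ : ℝ → ℝ
  - x = mkℝ (λ n → ℚ.- seq x n) (neg-cauchy x)

  -- The sequence takes the value 0 at the (finitely many) indices where the
  -- sequence of x may still vanish.
  recip : (x : ℝ) → 0ℝ < x → ℝ
  recip x 0<x = mkℝ (λ n → inv (seq x n)) (inv-cauchy x 0<x)

_-_ : ℝ → ℝ → ℝ
x - y = x + (- y)

_² : ℝ → ℝ
x ² = x * x

_/_[_] : (x y : ℝ) → 0ℝ < y → ℝ
x / y [ 0<y ] = x * recip y 0<y

opaque
  unfolding _+_

  ℕ+²-positive : ∀ k {α} → 0ℝ < α → 0ℝ < fromℕ k + α ²
  ℕ+²-positive k {α} (c , 0<c , N , h) = c ℚ.* c , 0<*0< 0<c 0<c , N , λ n N≤n →
    let c≤α = subst (ℚ._≤ seq α n) (ℚ.+-identityˡ c) (h n N≤n) in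
    ℚ.+-mono-≤
      (ℚ.nonNegative⁻¹ (+ k ℚ./ 1) {{ℚ.normalize-nonNeg k 1}})
      (*-mono-≤ (ℚ.<⇒≤ (ℚ.<-≤-trans 0<c c≤α)) (ℚ.<⇒≤ 0<c) c≤α c≤α)

------------------------------------------------------------------------
-- Matrices (entry (i , j) of A is A i j)

+-rawMonoid : RawMonoid 0ℓ 0ℓ
+-rawMonoid = record { Carrier = ℝ ; _≈_ = _≈_ ; _∙_ = _+_ ; ε = 0ℝ }

open RawMonoidDefs +-rawMonoid public using (sum)

Matrix : ℕ → ℕ → Set
Matrix n m = Vector (Vector ℝ m) n

private
  variable
    l m n r : ℕ

infix  4 _≈ᵐ_
infixl 7 _*ᵐ_ _*ᵛ_

_≈ᵐ_ : Matrix n m → Matrix n m → Set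
A ≈ᵐ B = ∀ i j → A i j ≈ B i j

_*ᵐ_ : Matrix n m → Matrix m l → Matrix n l
(A *ᵐ B) i j = sum λ t → A i t * B t j

_*ᵛ_ : Matrix n m → Vector ℝ m → Vector ℝ n
(A *ᵛ v) i = sum λ t → A i t * v t

‖_‖² : Vector ℝ n → ℝ
‖ v ‖² = sum λ i → v i ²

-- The elements of a subset, in increasing order.
elements : (S : Subset m) → Fin ∣ S ∣ → Fin m
elements (true  ∷ S) zero    = zero
elements (true  ∷ S) (suc i) = suc (elements S i)
elements (false ∷ S) i       = suc (elements S i)

columns : Matrix n m → (S : Subset m) → Matrix n ∣ S ∣
columns X S i j = X i (elements S j)

LinearlyIndependent : Vector (Vector ℝ n) r → Set
LinearlyIndependent {r = r} b =
  ∀ (c : Vector ℝ r) → (∀ i → sum (λ j → c j * b j i) ≈ 0ℝ) → ∀ j → c j ≈ 0ℝ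

InSpan : Vector (Vector ℝ n) r → Vector ℝ n → Set
InSpan {r = r} b v = Σ (Vector ℝ r) λ c → ∀ i → v i ≈ sum (λ j → c j * b j i)

-- The column space of A has dimension r: it has a basis of r vectors.
HasRank : Matrix n m → ℕ → Set
HasRank {n} A r = Σ (Vector (Vector ℝ n) r) λ b →
  LinearlyIndependent b ×
  (∀ j → InSpan (transpose A) (b j)) ×
  (∀ j → InSpan b (transpose A j))

FullRank : Matrix n m → Set
FullRank {n} {m} A = HasRank A (n ℕ.⊓ m)

-- The four Penrose equations, which determine P = A†.
record IsPseudoInverse (A : Matrix n m) (P : Matrix m n) : Set where
  field
    APA≈A  : A *ᵐ P *ᵐ A ≈ᵐ A
    PAP≈P  : P *ᵐ A *ᵐ P ≈ᵐ P
    AP-sym : transpose (A *ᵐ P) ≈ᵐ A *ᵐ P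
    PA-sym : transpose (P *ᵐ A) ≈ᵐ P *ᵐ A

-- For c ≥ 0 this says ‖A v‖ ≤ c ‖v‖ for all v, squared to avoid square roots.
BoundsOperator : Matrix n m → ℝ → Set
BoundsOperator A c = ∀ v → ‖ A *ᵛ v ‖² ≤ c ² * ‖ v ‖²

-- s is the operator norm of A induced by the Euclidean norms, i.e. the least
-- c ≥ 0 such that ‖A v‖ ≤ c ‖v‖ for all v.
record IsSpectralNorm (A : Matrix n m) (s : ℝ) : Set where
  field
    nonNeg : 0ℝ ≤ s
    bounds : BoundsOperator A s
    least  : ∀ c → 0ℝ ≤ c → BoundsOperator A c → s ≤ c

{-# OPTIONS --safe #-}

-- Let d = m - n, and choose positive integers b, j with d b² ≤ j² ≤ (d + 1) b².  Let n - 1 columns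
-- of X be j e₁, …, j eₙ₋₁ and let the remaining d + 1 columns all be b eₙ.  The rows of X are
-- orthogonal with squared norms at least j², so ‖X†‖ ≤ 1 / j.  Any k ≥ n columns include some
-- b eₙ, so X_S X_S† eₙ = eₙ; as the last row of X_S has squared norm at most k b², this gives
-- ‖X_S†‖² ≥ 1 / (k b²).  Finally (m - k) / (k + α²) · 1 / j² ≤ 1 / (k b²), because
-- (m - k) b² ≤ d b² ≤ j².  (The natural ratio j / b = √(d + 1) is avoided in order
-- to stay rational.)

module Submission where

open import Defs
open import Algebra.Bundles using (CommutativeRing)
import Algebra.Consequences.Setoid as Consequences
import Algebra.Properties.Semiring.Sum as SemiringSum
import Algebra.Solver.Ring as RingSolver
open import Algebra.Solver.Ring.AlmostCommutativeRing
  using (fromCommutativeRing; _-Raw-AlmostCommutative⟶_)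
open import Data.Bool.Base using (true; false)
open import Data.Fin.Base as Fin using (Fin; zero; suc)
open import Data.Fin.Subset using (Subset; ∣_∣)
open import Data.Integer.Base as ℤ using (+_)
import Data.Integer.Properties as ℤ
import Data.Maybe.Base as Maybe
open import Data.Nat.Base as ℕ using (ℕ; zero; suc)
import Data.Nat.Properties as ℕ
import Data.Nat.Solver as ℕ
open import Data.Product.Base using (Σ; ∃; ∃₂; _×_; _,_; proj₁; proj₂)
open import Data.Rational.Base as ℚ using (ℚ; 0ℚ; 1ℚ; ½)
import Data.Rational.Properties as ℚ
open import Data.Rational.Solver using (module +-*-Solver)
open import Data.Rational.Unnormalised.Base as ℚᵘ using (mkℚᵘ; *≡*)
import Data.Rational.Unnormalised.Properties as ℚᵘ
open import Data.Sum.Base as Sum using (_⊎_; inj₁; inj₂)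
open import Data.Vec.Base using ([]; _∷_)
open import Data.Vec.Functional using (Vector; transpose)
open import Level using (0ℓ)
open import Relation.Binary.Bundles using (Setoid)
open import Relation.Binary.PropositionalEquality as ≡
  using (_≡_; refl; cong; cong₂; subst; subst₂)
import Relation.Binary.Reasoning.Setoid as SetoidReasoning
open import Relation.Nullary using (yes; no; contradiction)
open import Relation.Nullary.Decidable.Core using (dec⇒maybe)

private
  variable
    m n : ℕ

-- Rational estimates and the commutative ring of real numbers.

-- A record, so that both sides can be inferred from the type of an equation.
infix 4 _≃_
record _≃_ (x y : ℝ) : Set where
  constructor ≈⇒≃
  field ≃⇒≈ : x ≈ y

open _≃_

module _ where
  open +-*-Solver
  open ℚ.≤-Reasoning

  ∣p-p∣≡0 : ∀ p → ℚ.∣ p ℚ.- p ∣ ≡ 0ℚ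
  ∣p-p∣≡0 p = cong ℚ.∣_∣ (ℚ.+-inverseʳ p)

  ∣p-q∣≡∣q-p∣ : ∀ p q → ℚ.∣ p ℚ.- q ∣ ≡ ℚ.∣ q ℚ.- p ∣
  ∣p-q∣≡∣q-p∣ p q = ≡.trans (≡.sym (ℚ.∣-p∣≡∣p∣ (p ℚ.- q)))
    (cong ℚ.∣_∣ (solve 2 (λ p q → :- (p :- q) := q :- p) refl p q))

  p≤∣p∣ : ∀ p → p ℚ.≤ ℚ.∣ p ∣
  p≤∣p∣ p with ℚ.≤-total 0ℚ p
  ... | inj₁ 0≤p = ℚ.≤-reflexive (≡.sym (ℚ.0≤p⇒∣p∣≡p 0≤p))
  ... | inj₂ p≤0 = ℚ.≤-trans p≤0 (ℚ.0≤∣p∣ p)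

  0≤+ : ∀ {p q} → 0ℚ ℚ.≤ p → 0ℚ ℚ.≤ q → 0ℚ ℚ.≤ p ℚ.+ q
  0≤+ = ℚ.+-mono-≤

  0≤* : ∀ {p q} → 0ℚ ℚ.≤ p → 0ℚ ℚ.≤ q → 0ℚ ℚ.≤ p ℚ.* q
  0≤* {p} {q} 0≤p 0≤q = ℚ.nonNegative⁻¹ (p ℚ.* q)
    {{ℚ.nonNeg*nonNeg⇒nonNeg p {{ℚ.nonNegative 0≤p}} q {{ℚ.nonNegative 0≤q}}}}

  0≤p² : ∀ p → 0ℚ ℚ.≤ p ℚ.* p
  0≤p² p = subst (0ℚ ℚ.≤_) ∣p∣²≡p² (0≤* (ℚ.0≤∣p∣ p) (ℚ.0≤∣p∣ p))
    where
    ∣p∣²≡p² : ℚ.∣ p ∣ ℚ.* ℚ.∣ p ∣ ≡ p ℚ.* p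
    ∣p∣²≡p² with ℚ.∣p∣≡p∨∣p∣≡-p p
    ... | inj₁ e = cong₂ ℚ._*_ e e
    ... | inj₂ e = ≡.trans (cong₂ ℚ._*_ e e) (solve 1 (λ p → :- p :* :- p := p :* p) refl p)

  ≤⇒0≤ : ∀ {p q} → p ℚ.≤ q → 0ℚ ℚ.≤ q ℚ.- p
  ≤⇒0≤ {p} {q} p≤q = subst (ℚ._≤ q ℚ.- p) (ℚ.+-inverseʳ p) (ℚ.+-monoˡ-≤ (ℚ.- p) p≤q)

  inverse : ∀ p → 0ℚ ℚ.< p → ∃ λ r → 0ℚ ℚ.< r × r ℚ.* p ≡ 1ℚ
  inverse p 0<p = (ℚ.1/ p) {{nz}} , ℚ.positive⁻¹ _ {{ℚ.1/pos⇒pos p {{ℚ.positive 0<p}}}}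
                , ℚ.*-inverseˡ p {{nz}}
    where
    nz : ℚ.NonZero p
    nz = ℚ.pos⇒nonZero p {{ℚ.positive 0<p}}

  0<* : ∀ {p q} → 0ℚ ℚ.< p → 0ℚ ℚ.< q → 0ℚ ℚ.< p ℚ.* q
  0<* {p} {q} 0<p 0<q = ℚ.positive⁻¹ (p ℚ.* q)
    {{ℚ.pos*pos⇒pos p {{ℚ.positive 0<p}} q {{ℚ.positive 0<q}}}}

  divide : ∀ p ε → 0ℚ ℚ.< p → 0ℚ ℚ.< ε → ∃ λ δ → 0ℚ ℚ.< δ × δ ℚ.* p ≡ ε
  divide p ε 0<p 0<ε with r , 0<r , rp≡1 ← inverse p 0<p =
    ε ℚ.* r , 0<* 0<ε 0<r ,
    ≡.trans (ℚ.*-assoc ε r p) (≡.trans (cong (ε ℚ.*_) rp≡1) (ℚ.*-identityʳ ε))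

  split : ∀ ε → 0ℚ ℚ.< ε → ∃ λ δ → 0ℚ ℚ.< δ × δ ℚ.+ δ ≡ ε
  split ε 0<ε = ½ ℚ.* ε , 0<* {½} {ε} (ℚ.positive⁻¹ ½) 0<ε
              , ≡.trans (≡.sym (ℚ.*-distribʳ-+ ε ½ ½)) (ℚ.*-identityˡ ε)

  bounded : ∀ x → ∃ λ B → 0ℚ ℚ.< B × Eventually λ n → ℚ.∣ seq x n ∣ ℚ.≤ B
  bounded x with cauchy x 1ℚ (ℚ.positive⁻¹ 1ℚ)
  ... | N , h = 1ℚ ℚ.+ ℚ.∣ seq x N ∣
              , ℚ.+-mono-<-≤ (ℚ.positive⁻¹ 1ℚ) (ℚ.0≤∣p∣ (seq x N))
              , N , λ n N≤n → begin
    ℚ.∣ seq x n ∣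
      ≡⟨ cong ℚ.∣_∣ (solve 2 (λ a b → a := (a :- b) :+ b) refl (seq x n) (seq x N)) ⟩
    ℚ.∣ (seq x n ℚ.- seq x N) ℚ.+ seq x N ∣
      ≤⟨ ℚ.∣p+q∣≤∣p∣+∣q∣ (seq x n ℚ.- seq x N) (seq x N) ⟩
    ℚ.∣ seq x n ℚ.- seq x N ∣ ℚ.+ ℚ.∣ seq x N ∣
      ≤⟨ ℚ.+-monoˡ-≤ ℚ.∣ seq x N ∣ (h n N N≤n ℕ.≤-refl) ⟩
    1ℚ ℚ.+ ℚ.∣ seq x N ∣ ∎

  both : ∀ {P Q : ℕ → Set} → Eventually P → Eventually Q → Eventually λ n → P n × Q n
  both (M , p) (N , q) = M ℕ.⊔ N , λ n MN≤n →
    p n (ℕ.m⊔n≤o⇒m≤o M N MN≤n) , q n (ℕ.m⊔n≤o⇒n≤o M N MN≤n)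

  eventually-map : ∀ {P Q : ℕ → Set} → (∀ n → P n → Q n) → Eventually P → Eventually Q
  eventually-map f (N , p) = N , λ n N≤n → f n (p n N≤n)

  -- Finitely many indices do not affect `_≈_`. The weak premise serves `recip`, whose entries are
  -- guaranteed to be inverses only from some index on.
  eventually≡⇒≃ : ∀ {x y} → (Eventually λ n → seq x n ≡ seq y n) → x ≃ y
  eventually≡⇒≃ {x} {y} x≡y = ≈⇒≃ λ ε 0<ε → eventually-map
    (λ n e → ℚ.≤-trans (ℚ.≤-reflexive
      (≡.trans (cong (λ t → ℚ.∣ t ℚ.- seq y n ∣) e) (∣p-p∣≡0 (seq y n)))) (ℚ.<⇒≤ 0<ε))
    x≡y

  pointwise : ∀ {x y} → (∀ n → seq x n ≡ seq y n) → x ≃ y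
  pointwise x≡y = eventually≡⇒≃ (0 , λ n _ → x≡y n)

  ≃-refl : ∀ {x} → x ≃ x
  ≃-refl = pointwise λ _ → refl

  ≃-reflexive : ∀ {x y} → x ≡ y → x ≃ y
  ≃-reflexive refl = ≃-refl

  ≃-sym : ∀ {x y} → x ≃ y → y ≃ x
  ≃-sym {x} {y} (≈⇒≃ x≈y) = ≈⇒≃ λ ε 0<ε → eventually-map
    (λ n → subst (ℚ._≤ ε) (∣p-q∣≡∣q-p∣ (seq x n) (seq y n))) (x≈y ε 0<ε)

  ≃-trans : ∀ {x y z} → x ≃ y → y ≃ z → x ≃ z
  ≃-trans {x} {y} {z} (≈⇒≃ x≈y) (≈⇒≃ y≈z) = ≈⇒≃ λ ε 0<ε →
    let δ , 0<δ , δ+δ≡ε = split ε 0<ε in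
    eventually-map (λ n (p , q) → begin
      ℚ.∣ seq x n ℚ.- seq z n ∣
        ≡⟨ cong ℚ.∣_∣ (solve 3 (λ a b c → a :- c := (a :- b) :+ (b :- c))
             refl (seq x n) (seq y n) (seq z n)) ⟩
      ℚ.∣ (seq x n ℚ.- seq y n) ℚ.+ (seq y n ℚ.- seq z n) ∣
        ≤⟨ ℚ.∣p+q∣≤∣p∣+∣q∣ (seq x n ℚ.- seq y n) (seq y n ℚ.- seq z n) ⟩
      ℚ.∣ seq x n ℚ.- seq y n ∣ ℚ.+ ℚ.∣ seq y n ℚ.- seq z n ∣
        ≤⟨ ℚ.+-mono-≤ p q ⟩
      δ ℚ.+ δ
        ≡⟨ δ+δ≡ε ⟩
      ε ∎)
    (both (x≈y δ 0<δ) (y≈z δ 0<δ))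

  opaque
    unfolding _+_

    +-congʳ : ∀ {x y} z → x ≃ y → x + z ≃ y + z
    +-congʳ {x} {y} z (≈⇒≃ x≈y) = ≈⇒≃ λ ε 0<ε → eventually-map
      (λ n → subst (ℚ._≤ ε) (cong ℚ.∣_∣
        (solve 3 (λ a b c → a :- b := (a :+ c) :- (b :+ c)) refl (seq x n) (seq y n) (seq z n))))
      (x≈y ε 0<ε)

    *-congʳ : ∀ {x y} z → x ≃ y → x * z ≃ y * z
    *-congʳ {x} {y} z (≈⇒≃ x≈y) = ≈⇒≃ λ ε 0<ε →
      let B , 0<B , z≤B = bounded z
          δ , 0<δ , δB≡ε = divide B ε 0<B 0<ε in
      eventually-map (λ n (p , q) → begin
        ℚ.∣ seq x n ℚ.* seq z n ℚ.- seq y n ℚ.* seq z n ∣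
          ≡⟨ cong ℚ.∣_∣ (solve 3 (λ a b c → a :* c :- b :* c := (a :- b) :* c)
               refl (seq x n) (seq y n) (seq z n)) ⟩
        ℚ.∣ (seq x n ℚ.- seq y n) ℚ.* seq z n ∣
          ≡⟨ ℚ.∣p*q∣≡∣p∣*∣q∣ (seq x n ℚ.- seq y n) (seq z n) ⟩
        ℚ.∣ seq x n ℚ.- seq y n ∣ ℚ.* ℚ.∣ seq z n ∣
          ≤⟨ ℚ.*-monoʳ-≤-nonNeg ℚ.∣ seq z n ∣ {{ℚ.∣-∣-nonNeg (seq z n)}} p ⟩
        δ ℚ.* ℚ.∣ seq z n ∣
          ≤⟨ ℚ.*-monoˡ-≤-nonNeg δ {{ℚ.nonNegative (ℚ.<⇒≤ 0<δ)}} q ⟩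
        δ ℚ.* B
          ≡⟨ δB≡ε ⟩
        ε ∎)
      (both (x≈y δ 0<δ) z≤B)

    neg-cong : ∀ {x y} → x ≃ y → - x ≃ - y
    neg-cong {x} {y} (≈⇒≃ x≈y) = ≈⇒≃ λ ε 0<ε → eventually-map
      (λ n → subst (ℚ._≤ ε) (≡.trans (∣p-q∣≡∣q-p∣ (seq x n) (seq y n)) (cong ℚ.∣_∣
        (solve 2 (λ a b → b :- a := :- a :- :- b) refl (seq x n) (seq y n)))))
      (x≈y ε 0<ε)

    +-comm : ∀ x y → x + y ≃ y + x
    +-comm x y = pointwise λ n → ℚ.+-comm (seq x n) (seq y n)

    *-comm : ∀ x y → x * y ≃ y * x
    *-comm x y = pointwise λ n → ℚ.*-comm (seq x n) (seq y n)

    +-assoc : ∀ x y z → (x + y) + z ≃ x + (y + z)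
    +-assoc x y z = pointwise λ n → ℚ.+-assoc (seq x n) (seq y n) (seq z n)

    *-assoc : ∀ x y z → (x * y) * z ≃ x * (y * z)
    *-assoc x y z = pointwise λ n → ℚ.*-assoc (seq x n) (seq y n) (seq z n)

    +-identityˡ : ∀ x → 0ℝ + x ≃ x
    +-identityˡ x = pointwise λ n → ℚ.+-identityˡ (seq x n)

    *-identityˡ : ∀ x → 1ℝ * x ≃ x
    *-identityˡ x = pointwise λ n → ℚ.*-identityˡ (seq x n)

    +-inverseˡ : ∀ x → - x + x ≃ 0ℝ
    +-inverseˡ x = pointwise λ n → ℚ.+-inverseˡ (seq x n)

    *-distribˡ-+ : ∀ x y z → x * (y + z) ≃ x * y + x * z
    *-distribˡ-+ x y z = pointwise λ n → ℚ.*-distribˡ-+ (seq x n) (seq y n) (seq z n)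

    fromℚ-+ : ∀ p q → fromℚ (p ℚ.+ q) ≃ fromℚ p + fromℚ q
    fromℚ-+ p q = pointwise λ _ → refl

    fromℚ-* : ∀ p q → fromℚ (p ℚ.* q) ≃ fromℚ p * fromℚ q
    fromℚ-* p q = pointwise λ _ → refl

    fromℚ-neg : ∀ p → fromℚ (ℚ.- p) ≃ - fromℚ p
    fromℚ-neg p = pointwise λ _ → refl

≃-setoid : Setoid 0ℓ 0ℓ
≃-setoid = record
  { _≈_ = _≃_ ; isEquivalence = record { refl = ≃-refl ; sym = ≃-sym ; trans = ≃-trans } }

ℝ-commutativeRing : CommutativeRing 0ℓ 0ℓ
ℝ-commutativeRing = record
  { Carrier = ℝ ; _≈_ = _≃_ ; _+_ = _+_ ; _*_ = _*_ ; -_ = -_ ; 0# = 0ℝ ; 1# = 1ℝ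
  ; isCommutativeRing = record
    { isRing = record
      { +-isAbelianGroup = record
        { isGroup = record
          { isMonoid = record
            { isSemigroup = record
              { isMagma = record
                { isEquivalence = Setoid.isEquivalence ≃-setoid
                ; ∙-cong = +-cong′ }
              ; assoc = +-assoc }
            ; identity = comm∧idˡ⇒id +-comm +-identityˡ }
          ; inverse = comm∧invˡ⇒inv +-comm +-inverseˡ
          ; ⁻¹-cong = neg-cong }
        ; comm = +-comm }
      ; *-cong = *-cong′
      ; *-assoc = *-assoc
      ; *-identity = comm∧idˡ⇒id *-comm *-identityˡ
      ; distrib = comm∧distrˡ⇒distr +-cong′ *-comm *-distribˡ-+
      }
    ; *-comm = *-comm } }
  where
  open Consequences ≃-setoid
  +-cong′ : ∀ {x y u v} → x ≃ y → u ≃ v → x + u ≃ y + v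
  +-cong′ {x} {y} {u} {v} p q = ≃-trans (+-congʳ u p)
    (≃-trans (+-comm y u) (≃-trans (+-congʳ y q) (+-comm v y)))
  *-cong′ : ∀ {x y u v} → x ≃ y → u ≃ v → x * u ≃ y * v
  *-cong′ {x} {y} {u} {v} p q = ≃-trans (*-congʳ u p)
    (≃-trans (*-comm y u) (≃-trans (*-congʳ y q) (*-comm v y)))

-- Coefficients of the ring solver are compared in ℚ, where equality is decidable, and enter the
-- reals through `fromℚ`.
fromℚ-morphism : ℚ.+-*-rawRing -Raw-AlmostCommutative⟶ fromCommutativeRing ℝ-commutativeRing
fromℚ-morphism = record
  { ⟦_⟧ = fromℚ ; +-homo = fromℚ-+ ; *-homo = fromℚ-* ; -‿homo = fromℚ-neg
  ; 0-homo = ≃-refl ; 1-homo = ≃-refl }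

module ℝ-Solver = RingSolver ℚ.+-*-rawRing (fromCommutativeRing ℝ-commutativeRing)
  fromℚ-morphism (λ p q → Maybe.map (λ p≡q → ≃-reflexive (cong fromℚ p≡q)) (dec⇒maybe (p ℚ.≟ q)))

-- Nonnegative real numbers.

-- Inequalities are handled as nonnegativity of a difference: a ring identity writes the difference
-- through sums and products of nonnegative terms, and `NonNeg-resp-≃` transfers the result.
record NonNeg (x : ℝ) : Set where
  constructor nonNeg
  field eventually : ∀ ε → 0ℚ ℚ.< ε → Eventually λ n → 0ℚ ℚ.≤ seq x n ℚ.+ ε

eventually⇒NonNeg : ∀ {x} → (Eventually λ n → 0ℚ ℚ.≤ seq x n) → NonNeg x
eventually⇒NonNeg 0≤x = nonNeg λ ε 0<ε →
  eventually-map (λ n 0≤xn → 0≤+ 0≤xn (ℚ.<⇒≤ 0<ε)) 0≤x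

NonNeg-fromℚ : ∀ {p} → 0ℚ ℚ.≤ p → NonNeg (fromℚ p)
NonNeg-fromℚ 0≤p = eventually⇒NonNeg (0 , λ _ _ → 0≤p)

module _ where
  open +-*-Solver
  open ℚ.≤-Reasoning

  NonNeg-resp-≃ : ∀ {x y} → x ≃ y → NonNeg x → NonNeg y
  NonNeg-resp-≃ {x} {y} (≈⇒≃ x≈y) (nonNeg 0≤x) = nonNeg λ ε 0<ε →
    let δ , 0<δ , δ+δ≡ε = split ε 0<ε in
    eventually-map (λ n (p , q) → begin
      0ℚ
        ≤⟨ q ⟩
      seq x n ℚ.+ δ
        ≡⟨ solve 3 (λ a b d → a :+ d := b :+ ((a :- b) :+ d)) refl (seq x n) (seq y n) δ ⟩
      seq y n ℚ.+ ((seq x n ℚ.- seq y n) ℚ.+ δ)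
        ≤⟨ ℚ.+-monoʳ-≤ (seq y n) (ℚ.+-monoˡ-≤ δ (ℚ.≤-trans (p≤∣p∣ (seq x n ℚ.- seq y n)) p)) ⟩
      seq y n ℚ.+ (δ ℚ.+ δ)
        ≡⟨ cong (seq y n ℚ.+_) δ+δ≡ε ⟩
      seq y n ℚ.+ ε ∎)
    (both (x≈y δ 0<δ) (0≤x δ 0<δ))

  opaque
    unfolding _+_

    NonNeg-+ : ∀ {x y} → NonNeg x → NonNeg y → NonNeg (x + y)
    NonNeg-+ {x} {y} (nonNeg 0≤x) (nonNeg 0≤y) = nonNeg λ ε 0<ε →
      let δ , 0<δ , δ+δ≡ε = split ε 0<ε in
      eventually-map (λ n (p , q) → begin
        0ℚ
          ≤⟨ 0≤+ p q ⟩
        (seq x n ℚ.+ δ) ℚ.+ (seq y n ℚ.+ δ)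
          ≡⟨ solve 3 (λ a b d → (a :+ d) :+ (b :+ d) := (a :+ b) :+ (d :+ d))
               refl (seq x n) (seq y n) δ ⟩
        (seq x n ℚ.+ seq y n) ℚ.+ (δ ℚ.+ δ)
          ≡⟨ cong (seq x n ℚ.+ seq y n ℚ.+_) δ+δ≡ε ⟩
        (seq x n ℚ.+ seq y n) ℚ.+ ε ∎)
      (both (0≤x δ 0<δ) (0≤y δ 0<δ))

    -- The entries may be slightly negative, so each is shifted by `δ` before multiplying. With `A`
    -- and `B` bounding the sequences the shift costs at most `δ * C`, and `δ` is chosen to make
    -- this `ε`. The summand 1 in `C` ensures `δ ≤ ε`.
    NonNeg-* : ∀ {x y} → NonNeg x → NonNeg y → NonNeg (x * y)
    NonNeg-* {x} {y} (nonNeg 0≤x) (nonNeg 0≤y) = nonNeg λ ε 0<ε →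
      let A , 0<A , x≤A = bounded x
          B , 0<B , y≤B = bounded y
          0≤E : 0ℚ ℚ.≤ A ℚ.+ B ℚ.+ ε
          0≤E = 0≤+ (0≤+ (ℚ.<⇒≤ 0<A) (ℚ.<⇒≤ 0<B)) (ℚ.<⇒≤ 0<ε)
          C = 1ℚ ℚ.+ (A ℚ.+ B ℚ.+ ε)
          δ , 0<δ , δC≡ε = divide C ε (ℚ.+-mono-<-≤ (ℚ.positive⁻¹ 1ℚ) 0≤E) 0<ε
          0≤ε-δ : 0ℚ ℚ.≤ ε ℚ.- δ
          0≤ε-δ = subst (0ℚ ℚ.≤_)
            (≡.trans (solve 2 (λ d e → d :* e := d :* (con 1ℚ :+ e) :- d) refl δ (A ℚ.+ B ℚ.+ ε))
                     (cong (ℚ._- δ) δC≡ε))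
            (0≤* (ℚ.<⇒≤ 0<δ) 0≤E)
      in
      eventually-map (λ n ((p , q) , (r , s)) → begin
        0ℚ
          ≤⟨ 0≤+ (0≤* p q) (0≤* (ℚ.<⇒≤ 0<δ) (0≤+ (0≤+ (0≤+
               (≤⇒0≤ (ℚ.≤-trans (p≤∣p∣ (seq x n)) r))
               (≤⇒0≤ (ℚ.≤-trans (p≤∣p∣ (seq y n)) s))) 0≤ε-δ) (ℚ.<⇒≤ (ℚ.positive⁻¹ 1ℚ)))) ⟩
        (seq x n ℚ.+ δ) ℚ.* (seq y n ℚ.+ δ)
          ℚ.+ δ ℚ.* ((A ℚ.- seq x n) ℚ.+ (B ℚ.- seq y n) ℚ.+ (ε ℚ.- δ) ℚ.+ 1ℚ)
          ≡⟨ solve 6 (λ a b A B e d →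
               (a :+ d) :* (b :+ d) :+ d :* ((A :- a) :+ (B :- b) :+ (e :- d) :+ con 1ℚ)
               := a :* b :+ d :* (con 1ℚ :+ (A :+ B :+ e)))
               refl (seq x n) (seq y n) A B ε δ ⟩
        seq x n ℚ.* seq y n ℚ.+ δ ℚ.* C
          ≡⟨ cong (seq x n ℚ.* seq y n ℚ.+_) δC≡ε ⟩
        seq x n ℚ.* seq y n ℚ.+ ε ∎)
      (both (both (0≤x δ 0<δ) (0≤y δ 0<δ)) (both x≤A y≤B))

    NonNeg-² : ∀ x → NonNeg (x * x)
    NonNeg-² x = eventually⇒NonNeg (0 , λ n _ → 0≤p² (seq x n))

    ≤⇒NonNeg : ∀ {x y} → x ≤ y → NonNeg (y - x)
    ≤⇒NonNeg {x} {y} x≤y = nonNeg λ ε 0<ε → eventually-map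
      (λ n p → subst (0ℚ ℚ.≤_)
        (solve 3 (λ a b e → (b :+ e) :- a := (b :- a) :+ e) refl (seq x n) (seq y n) ε)
        (≤⇒0≤ p))
      (x≤y ε 0<ε)

    NonNeg⇒≤ : ∀ {x y} → NonNeg (y - x) → x ≤ y
    NonNeg⇒≤ {x} {y} (nonNeg 0≤y-x) ε 0<ε = eventually-map
      (λ n p → begin
        seq x n
          ≡⟨ ℚ.+-identityʳ (seq x n) ⟨
        seq x n ℚ.+ 0ℚ
          ≤⟨ ℚ.+-monoʳ-≤ (seq x n) p ⟩
        seq x n ℚ.+ ((seq y n ℚ.- seq x n) ℚ.+ ε)
          ≡⟨ solve 3 (λ a b e → a :+ ((b :- a) :+ e) := b :+ e) refl (seq x n) (seq y n) ε ⟩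
        seq y n ℚ.+ ε ∎)
      (0≤y-x ε 0<ε)

    -- The witness of `0ℝ < x` bounds the entries away from 0 only from some index on; before it,
    -- `inv` may meet a zero or negative entry.
    recip-eventually : ∀ x (0<x : 0ℝ < x) → Eventually λ n →
      0ℚ ℚ.≤ seq (recip x 0<x) n × seq x n ℚ.* seq (recip x 0<x) n ≡ 1ℚ
    recip-eventually x (ε , 0<ε , h) = eventually-map
      (λ n p → inv-pos (seq x n) (ℚ.<-≤-trans 0<ε (subst (ℚ._≤ seq x n) (ℚ.+-identityˡ ε) p))) h
      where
      inv-pos : ∀ q → 0ℚ ℚ.< q → 0ℚ ℚ.≤ inv q × q ℚ.* inv q ≡ 1ℚ
      inv-pos q 0<q with q ℚ.≟ 0ℚ
      ... | yes q≡0 = contradiction (≡.sym q≡0) (ℚ.<⇒≢ 0<q)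
      ... | no q≢0  = ℚ.<⇒≤ (ℚ.positive⁻¹ _ {{ℚ.1/pos⇒pos q {{ℚ.positive 0<q}}}})
                    , ℚ.*-inverseʳ q {{ℚ.≢-nonZero q≢0}}

    *-recip : ∀ x 0<x → x * recip x 0<x ≃ 1ℝ
    *-recip x 0<x = eventually≡⇒≃ (eventually-map (λ _ → proj₂) (recip-eventually x 0<x))

    NonNeg-recip : ∀ x 0<x → NonNeg (recip x 0<x)
    NonNeg-recip x 0<x = eventually⇒NonNeg (eventually-map (λ _ → proj₁) (recip-eventually x 0<x))

-- Natural numbers as rationals, and integer square roots.

cast : ℕ → ℚ
cast n = + n ℚ./ 1

-- Unnormalised fractions with denominator 1 reduce the laws of `cast` to integer arithmetic, away
-- from the gcd normalisation of ℚ.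
toℚᵘ-cast : ∀ n → ℚ.toℚᵘ (cast n) ℚᵘ.≃ mkℚᵘ (+ n) 0
toℚᵘ-cast n = ℚ.toℚᵘ-fromℚᵘ (mkℚᵘ (+ n) 0)

cast-+ : ∀ a b → cast (a ℕ.+ b) ≡ cast a ℚ.+ cast b
cast-+ a b = ℚ.toℚᵘ-injective (ℚᵘ.≃-trans (toℚᵘ-cast (a ℕ.+ b)) (ℚᵘ.≃-trans
  (*≡* (cong (ℤ._* + 1) (≡.sym (cong₂ ℤ._+_ (ℤ.*-identityʳ (+ a)) (ℤ.*-identityʳ (+ b))))))
  (ℚᵘ.≃-sym (ℚᵘ.≃-trans (ℚ.toℚᵘ-homo-+ (cast a) (cast b))
    (ℚᵘ.+-cong (toℚᵘ-cast a) (toℚᵘ-cast b))))))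

cast-* : ∀ a b → cast (a ℕ.* b) ≡ cast a ℚ.* cast b
cast-* a b = ℚ.toℚᵘ-injective (ℚᵘ.≃-trans (toℚᵘ-cast (a ℕ.* b)) (ℚᵘ.≃-trans
  (*≡* (cong (ℤ._* + 1) (ℤ.pos-* a b)))
  (ℚᵘ.≃-sym (ℚᵘ.≃-trans (ℚ.toℚᵘ-homo-* (cast a) (cast b))
    (ℚᵘ.*-cong (toℚᵘ-cast a) (toℚᵘ-cast b))))))

0≤cast : ∀ n → 0ℚ ℚ.≤ cast n
0≤cast n = ℚ.nonNegative⁻¹ (cast n) {{ℚ.normalize-nonNeg n 1}}

0<cast : ∀ n → 0ℚ ℚ.< cast (suc n)
0<cast n = ℚ.positive⁻¹ (cast (suc n)) {{ℚ.normalize-pos (suc n) 1}}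

cast-mono : ∀ {a b} → a ℕ.≤ b → cast a ℚ.≤ cast b
cast-mono {a} a≤b with o , refl ← ℕ.m≤n⇒∃[o]m+o≡n a≤b = shift (ℚ.+-monoʳ-≤ (cast a) (0≤cast o))
  where
  shift : cast a ℚ.+ 0ℚ ℚ.≤ cast a ℚ.+ cast o → cast a ℚ.≤ cast (a ℕ.+ o)
  shift = subst₂ ℚ._≤_ (ℚ.+-identityʳ (cast a)) (≡.sym (cast-+ a o))

floor-sqrt : ∀ n → ∃ λ i → i ℕ.* i ℕ.≤ n × n ℕ.< suc i ℕ.* suc i
floor-sqrt zero = 0 , ℕ.z≤n , ℕ.s≤s ℕ.z≤n
floor-sqrt (suc n) with i , i²≤n , n<j² ← floor-sqrt n | suc i ℕ.* suc i ℕ.≤? suc n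
... | no j²≰sn  = i , ℕ.m≤n⇒m≤1+n i²≤n , ℕ.≰⇒> j²≰sn
... | yes j²≤sn = suc i , j²≤sn ,
  ℕ.<-≤-trans (ℕ.s≤s n<j²) (ℕ.*-mono-< (ℕ.n<1+n (suc i)) (ℕ.n<1+n (suc i)))

module _ where
  open ℕ.+-*-Solver
  open ℕ.≤-Reasoning

  -- Near b²d, with b = 2d, consecutive squares differ by at most b².
  square-between : ∀ d → ∃₂ λ b j →
    suc d ℕ.* (suc b ℕ.* suc b) ℕ.≤ suc j ℕ.* suc j ×
    suc j ℕ.* suc j ℕ.≤ suc (suc d) ℕ.* (suc b ℕ.* suc b)
  square-between d = d ℕ.+ suc d , i , proj₂ (proj₂ root) , (begin
    suc i ℕ.* suc i
      ≡⟨ solve 1 (λ i → (con 1 :+ i) :* (con 1 :+ i) := con 1 :+ i :* i :+ (i :+ i)) refl i ⟩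
    suc (i ℕ.* i) ℕ.+ (i ℕ.+ i)
      ≤⟨ ℕ.+-mono-≤ i²<b²d (ℕ.+-mono-≤ (ℕ.<⇒≤ i<bd) (ℕ.<⇒≤ i<bd)) ⟩
    suc d ℕ.* (b ℕ.* b) ℕ.+ (b ℕ.* suc d ℕ.+ b ℕ.* suc d)
      ≡⟨ solve 2 (λ d b → d :* (b :* b) :+ (b :* d :+ b :* d) := b :* (d :+ d) :+ d :* (b :* b))
           refl (suc d) b ⟩
    suc (suc d) ℕ.* (b ℕ.* b) ∎)
    where
    b = suc d ℕ.+ suc d
    -- Taking the root of the predecessor makes `i * i` strictly smaller than the target, so `suc i`
    -- is the least integer whose square reaches it.
    root = floor-sqrt (ℕ.pred (suc d ℕ.* (b ℕ.* b)))
    i = proj₁ root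
    i²<b²d : i ℕ.* i ℕ.< suc d ℕ.* (b ℕ.* b)
    i²<b²d = ℕ.s≤s (proj₁ (proj₂ root))
    -- With D = d + 1: i² < D b² ≤ (D b)² forces i < D b. Then 2 i ≤ 2 D b = b², which is the gap
    -- between the two bounds on the square.
    i<bd : i ℕ.< b ℕ.* suc d
    i<bd with i ℕ.<? b ℕ.* suc d
    ... | yes i<bd = i<bd
    ... | no i≮bd  = contradiction i²<b²d (ℕ.≤⇒≯ (begin
      suc d ℕ.* (b ℕ.* b)
        ≤⟨ ℕ.m≤m*n (suc d ℕ.* (b ℕ.* b)) (suc d) ⟩
      suc d ℕ.* (b ℕ.* b) ℕ.* suc d
        ≡⟨ solve 2 (λ d b → d :* (b :* b) :* d := (b :* d) :* (b :* d)) refl (suc d) b ⟩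
      b ℕ.* suc d ℕ.* (b ℕ.* suc d)
        ≤⟨ ℕ.*-mono-≤ (ℕ.≮⇒≥ i≮bd) (ℕ.≮⇒≥ i≮bd) ⟩
      i ℕ.* i ∎))

-- Finite sums and the Kronecker delta.

module R = CommutativeRing ℝ-commutativeRing
open SemiringSum R.semiring using (sum-cong-≋; *-distribˡ-sum; ∑-distrib-+)
open SetoidReasoning R.setoid
open ℝ-Solver using (solve; _:=_; _:+_; _:*_; _:-_; :-_; con)

sum-cong : {f g : Vector ℝ n} → (∀ i → f i ≃ g i) → sum f ≃ sum g
sum-cong = sum-cong-≋

*-sum : ∀ c (f : Vector ℝ n) → c * sum f ≃ sum (λ i → c * f i)
*-sum = *-distribˡ-sum

NonNeg-0 : NonNeg 0ℝ
NonNeg-0 = NonNeg-fromℚ ℚ.≤-refl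

sum-const : ∀ n c → sum {n} (λ _ → c) ≃ fromℚ (cast n) * c
sum-const zero    c = R.sym (R.zeroˡ c)
sum-const (suc n) c = begin
  c + sum {n} (λ _ → c)        ≈⟨ R.+-congˡ (sum-const n c) ⟩
  c + fromℚ (cast n) * c       ≈⟨ solve 2 (λ c q → c :+ q :* c := (con 1ℚ :+ q) :* c) R.refl
                                    c (fromℚ (cast n)) ⟩
  (1ℝ + fromℚ (cast n)) * c    ≈⟨ R.*-congʳ (fromℚ-+ 1ℚ (cast n)) ⟨
  fromℚ (1ℚ ℚ.+ cast n) * c    ≡⟨ cong (λ q → fromℚ q * c) (cast-+ 1 n) ⟨
  fromℚ (cast (suc n)) * c     ∎

NonNeg-sum-difference : (f g : Vector ℝ n) → (∀ i → NonNeg (g i - f i)) → NonNeg (sum g - sum f)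
NonNeg-sum-difference {zero}  f g f≤g = NonNeg-resp-≃ (R.sym (R.-‿inverseʳ 0ℝ)) NonNeg-0
NonNeg-sum-difference {suc n} f g f≤g = NonNeg-resp-≃
  (solve 4 (λ a b c d → (a :- b) :+ (c :- d) := (a :+ c) :- (b :+ d)) R.refl
    (g zero) (f zero) (sum λ i → g (suc i)) (sum λ i → f (suc i)))
  (NonNeg-+ (f≤g zero) (NonNeg-sum-difference (λ i → f (suc i)) (λ i → g (suc i)) λ i → f≤g (suc i)))

δ : Fin n → Fin n → ℝ
δ zero    zero    = 1ℝ
δ zero    (suc _) = 0ℝ
δ (suc _) zero    = 0ℝ
δ (suc i) (suc j) = δ i j

δ-sym : ∀ (i j : Fin n) → δ i j ≡ δ j i
δ-sym zero    zero    = refl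
δ-sym zero    (suc j) = refl
δ-sym (suc i) zero    = refl
δ-sym (suc i) (suc j) = δ-sym i j

δ-refl : ∀ (i : Fin n) → δ i i ≡ 1ℝ
δ-refl zero    = refl
δ-refl (suc i) = δ-refl i

δ-cases : ∀ (i j : Fin n) → δ i j ≡ 0ℝ ⊎ (i ≡ j × δ i j ≡ 1ℝ)
δ-cases zero    zero    = inj₂ (refl , refl)
δ-cases zero    (suc j) = inj₁ refl
δ-cases (suc i) zero    = inj₁ refl
δ-cases (suc i) (suc j) with δ-cases i j
... | inj₁ δ≡0         = inj₁ δ≡0
... | inj₂ (refl , δ≡1) = inj₂ (refl , δ≡1)

sum-δ : ∀ (i : Fin n) (g : Vector ℝ n) → sum (λ r → δ i r * g r) ≃ g i
sum-δ {suc n} zero g = begin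
  1ℝ * g zero + sum (λ r → 0ℝ * g (suc r))   ≈⟨ R.+-congˡ (*-sum 0ℝ (λ r → g (suc r))) ⟨
  1ℝ * g zero + 0ℝ * sum (λ r → g (suc r))   ≈⟨ solve 2 (λ a b → con 1ℚ :* a :+ con 0ℚ :* b := a) R.refl
                                                  (g zero) (sum λ r → g (suc r)) ⟩
  g zero                                     ∎
sum-δ {suc n} (suc i) g = begin
  0ℝ * g zero + sum (λ r → δ i r * g (suc r))  ≈⟨ R.+-congˡ (sum-δ i (λ r → g (suc r))) ⟩
  0ℝ * g zero + g (suc i)                      ≈⟨ solve 2 (λ a b → con 0ℚ :* a :+ b := b) R.refl
                                                    (g zero) (g (suc i)) ⟩
  g (suc i)                                    ∎

sum-δʳ : ∀ (g : Vector ℝ n) i → sum (λ r → g r * δ r i) ≃ g i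
sum-δʳ g i = R.trans
  (sum-cong λ r → R.trans (R.*-comm (g r) (δ r i)) (R.*-congʳ (R.reflexive (δ-sym r i))))
  (sum-δ i g)

-- If A has a column w eᵢ with w invertible, then A P A = A forces A P eᵢ = eᵢ.
projection-fixes : (A : Matrix n m) (P : Matrix m n) → A *ᵐ P *ᵐ A ≈ᵐ A →
  ∀ s i {w u} → u * w ≃ 1ℝ → (∀ q → A q s ≃ w * δ q i) → ∀ r → (A *ᵐ P) r i ≃ δ r i
projection-fixes A P APA≈A s i {w} {u} uw≃1 column r = begin
  (A *ᵐ P) r i                                  ≈⟨ R.*-identityˡ _ ⟨
  1ℝ * (A *ᵐ P) r i                             ≈⟨ R.*-congʳ uw≃1 ⟨
  u * w * (A *ᵐ P) r i                          ≈⟨ R.*-assoc u w _ ⟩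
  u * (w * (A *ᵐ P) r i)                        ≈⟨ R.*-congˡ (R.*-congˡ (sum-δʳ (λ q → (A *ᵐ P) r q) i)) ⟨
  u * (w * sum (λ q → (A *ᵐ P) r q * δ q i))    ≈⟨ R.*-congˡ (*-sum w (λ q → (A *ᵐ P) r q * δ q i)) ⟩
  u * sum (λ q → w * ((A *ᵐ P) r q * δ q i))    ≈⟨ R.*-congˡ (sum-cong λ q → R.trans
                                                     (solve 3 (λ w a d → w :* (a :* d) := a :* (w :* d)) R.refl
                                                       w ((A *ᵐ P) r q) (δ q i))
                                                     (R.*-congˡ (R.sym (column q)))) ⟩
  u * sum (λ q → (A *ᵐ P) r q * A q s)          ≈⟨ R.*-congˡ (≈⇒≃ (APA≈A r s)) ⟩
  u * A r s                                     ≈⟨ R.*-congˡ (column r) ⟩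
  u * (w * δ r i)                               ≈⟨ R.*-assoc u w _ ⟨
  u * w * δ r i                                 ≈⟨ R.*-congʳ uw≃1 ⟩
  1ℝ * δ r i                                    ≈⟨ R.*-identityˡ _ ⟩
  δ r i                                         ∎

-- The pattern of nonzero entries.

-- The row of the nonzero entry of a column: min (t, n), counting from 0.
ρ : ∀ N n → Fin (n ℕ.+ N) → Fin (suc n)
ρ N zero    t       = zero
ρ N (suc n) zero    = zero
ρ N (suc n) (suc t) = suc (ρ N n t)

-- A section of `ρ (suc N) n`, picking the first of the repeated columns for the last row. The
-- `suc N` ensures that there is one.
ι : ∀ N n → Fin (suc n) → Fin (n ℕ.+ suc N)
ι N zero    i       = zero
ι N (suc n) zero    = zero
ι N (suc n) (suc i) = suc (ι N n i)

ρ-ι : ∀ N n i → ρ (suc N) n (ι N n i) ≡ i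
ρ-ι N zero    zero    = refl
ρ-ι N (suc n) zero    = refl
ρ-ι N (suc n) (suc i) = cong suc (ρ-ι N n i)

-- The cardinality of the fibre of `ρ N n` over a row.
multiplicity : ∀ N n → Fin (suc n) → ℕ
multiplicity N zero    _       = N
multiplicity N (suc n) zero    = 1
multiplicity N (suc n) (suc i) = multiplicity N n i

-- Grouping the columns by fibres of `ρ`; this converts norms and products over columns into
-- weighted sums over rows.
sum-ρ : ∀ N n (g : Vector ℝ (suc n)) →
  sum (λ t → g (ρ N n t)) ≃ sum (λ r → fromℚ (cast (multiplicity N n r)) * g r)
sum-ρ N zero    g = R.trans (sum-const N (g zero)) (R.sym (R.+-identityʳ _))
sum-ρ N (suc n) g = R.+-cong (R.sym (R.*-identityˡ (g zero))) (sum-ρ N n (λ i → g (suc i)))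

-- Only the first `n` columns lie over earlier rows, so more than `n` columns cannot all avoid the
-- last row. Each step of the induction discards one of those `n`.
large-subset-meets-last : ∀ N n (S : Subset (n ℕ.+ N)) → n ℕ.< ∣ S ∣ →
  ∃ λ s → ρ N n (elements S s) ≡ Fin.fromℕ n
large-subset-meets-last N zero    S           n<∣S∣ = Fin.fromℕ< n<∣S∣ , refl
large-subset-meets-last N (suc n) (true ∷ S)  n<∣S∣
  with s , ρs≡last ← large-subset-meets-last N n S (ℕ.s<s⁻¹ n<∣S∣) =
  suc s , cong suc ρs≡last
large-subset-meets-last N (suc n) (false ∷ S) n<∣S∣
  with s , ρs≡last ← large-subset-meets-last N n S (ℕ.<-trans (ℕ.n<1+n n) n<∣S∣) =
  s , cong suc ρs≡last

-- The entry `w * d` is either 0 or `b`. In the first case the difference is p² + (μ b)², in the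
-- second it is the square (p - μ b)².
young : ∀ μ b p {w d} → d ≡ 0ℝ ⊎ (w ≡ b × d ≡ 1ℝ) →
  NonNeg (p * p - ((μ + μ) * (w * d * p) - μ * b * (μ * b)))
young μ b p {w} (inj₁ refl) = NonNeg-resp-≃
  (solve 4 (λ p l c w → p :* p :+ c :* c := p :* p :- ((l :+ l) :* (w :* con 0ℚ :* p) :- c :* c))
    R.refl p μ (μ * b) w)
  (NonNeg-+ (NonNeg-² p) (NonNeg-² (μ * b)))
young μ b p (inj₂ (refl , refl)) = NonNeg-resp-≃
  (solve 3 (λ p l b → (p :- l :* b) :* (p :- l :* b)
     := p :* p :- ((l :+ l) :* (b :* con 1ℚ :* p) :- (l :* b) :* (l :* b)))
    R.refl p μ b)
  (NonNeg-² (p - μ * b))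

-- The matrix X: row norms, rank, and the lower bound for its submatrices.

module _ (b j : ℚ) where

  weight : ∀ n → Fin (suc n) → ℚ
  weight zero    _       = b
  weight (suc n) zero    = j
  weight (suc n) (suc i) = weight n i

  weight-last : ∀ n → weight n (Fin.fromℕ n) ≡ b
  weight-last zero    = refl
  weight-last (suc n) = weight-last n

  weight-positive : 0ℚ ℚ.< b → 0ℚ ℚ.< j → ∀ n i → 0ℚ ℚ.< weight n i
  weight-positive 0<b 0<j zero    i       = 0<b
  weight-positive 0<b 0<j (suc n) zero    = 0<j
  weight-positive 0<b 0<j (suc n) (suc i) = weight-positive 0<b 0<j n i

  weight-inverse : 0ℚ ℚ.< b → 0ℚ ℚ.< j → ∀ n i → ∃ λ u → u * fromℚ (weight n i) ≃ 1ℝ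
  weight-inverse 0<b 0<j n i
    with u , _ , uw≡1 ← inverse (weight n i) (weight-positive 0<b 0<j n i) =
    fromℚ u , R.trans (R.sym (fromℚ-* u (weight n i))) (≃-reflexive (cong fromℚ uw≡1))

  -- The number of rows is `suc n`, so `N` = m - (n + 1) + 1 counts the copies of the last column.
  example : ∀ N n → Matrix (suc n) (n ℕ.+ N)
  example N n i t = fromℚ (weight n (ρ N n t)) * δ i (ρ N n t)

  -- The right-hand side is the squared norm of row `i`. It equals j² except in the last row, where
  -- the bound is the hypothesis.
  j²≤multiplicity*weight² : ∀ N → j ℚ.* j ℚ.≤ cast N ℚ.* (b ℚ.* b) → ∀ n i →
    j ℚ.* j ℚ.≤ cast (multiplicity N n i) ℚ.* (weight n i ℚ.* weight n i)
  j²≤multiplicity*weight² N j²≤Nb² zero    i       = j²≤Nb²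
  j²≤multiplicity*weight² N j²≤Nb² (suc n) zero    = ℚ.≤-reflexive (≡.sym (ℚ.*-identityˡ (j ℚ.* j)))
  j²≤multiplicity*weight² N j²≤Nb² (suc n) (suc i) = j²≤multiplicity*weight² N j²≤Nb² n i

  -- Row `i` of X is supported on the fibre over `i`, where it is constant. This evaluates products
  -- of X with anything that depends on a column only through `ρ`.
  sum-example : ∀ N n i (g : Vector ℝ (suc n)) →
    sum (λ t → example N n i t * g (ρ N n t)) ≃
    fromℚ (cast (multiplicity N n i)) * (fromℚ (weight n i) * g i)
  sum-example N n i g = begin
    sum (λ t → example N n i t * g (ρ N n t))
      ≈⟨ sum-ρ N n (λ r → fromℚ (weight n r) * δ i r * g r) ⟩
    sum (λ r → f r * (w r * δ i r * g r))
      ≈⟨ sum-cong (λ r → solve 4 (λ f w d g → f :* (w :* d :* g) := d :* (f :* (w :* g))) R.refl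
           (f r) (w r) (δ i r) (g r)) ⟩
    sum (λ r → δ i r * (f r * (w r * g r)))
      ≈⟨ sum-δ i (λ r → f r * (w r * g r)) ⟩
    f i * (w i * g i) ∎
    where
    f w : Vector ℝ (suc n)
    f r = fromℚ (cast (multiplicity N n r))
    w r = fromℚ (weight n r)

  -- The standard basis spans the column space, since each unit vector is the column chosen by `ι`
  -- divided by its weight.
  example-hasRank : 0ℚ ℚ.< b → 0ℚ ℚ.< j → ∀ N n → HasRank (example (suc N) n) (suc n)
  example-hasRank 0<b 0<j N n = δ , independent , basis-in-span , columns-in-span
    where
    X = example (suc N) n
    independent : LinearlyIndependent δ
    independent c sum≈0 i = ≃⇒≈ (R.trans (R.sym (sum-δʳ c i)) (≈⇒≃ {y = 0ℝ} (sum≈0 i)))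
    basis-in-span : ∀ i → InSpan (transpose X) (δ i)
    basis-in-span i =
      (λ t → u * δ (ι N n i) t) , λ r → ≃⇒≈ (R.sym (begin
        sum (λ t → u * δ (ι N n i) t * X r t)     ≈⟨ sum-cong (λ t → R.*-assoc u (δ (ι N n i) t) (X r t)) ⟩
        sum (λ t → u * (δ (ι N n i) t * X r t))   ≈⟨ *-sum u (λ t → δ (ι N n i) t * X r t) ⟨
        u * sum (λ t → δ (ι N n i) t * X r t)     ≈⟨ R.*-congˡ (sum-δ (ι N n i) (λ t → X r t)) ⟩
        u * X r (ι N n i)                         ≡⟨ cong (λ k → u * (fromℚ (weight n k) * δ r k))
                                                       (ρ-ι N n i) ⟩
        u * (fromℚ (weight n i) * δ r i)          ≈⟨ R.*-assoc u (fromℚ (weight n i)) (δ r i) ⟨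
        u * fromℚ (weight n i) * δ r i            ≈⟨ R.*-congʳ uw≃1 ⟩
        1ℝ * δ r i                                ≈⟨ R.*-identityˡ _ ⟩
        δ r i                                     ≡⟨ δ-sym r i ⟩
        δ i r                                     ∎))
      where
      u = proj₁ (weight-inverse 0<b 0<j n i)
      uw≃1 = proj₂ (weight-inverse 0<b 0<j n i)
    columns-in-span : ∀ t → InSpan δ (transpose X t)
    columns-in-span t = (λ i → X i t) , λ r → ≃⇒≈ (R.sym (sum-δʳ (λ i → X i t) r))

  -- An arbitrary selection `S` of columns covers both a submatrix, through `elements`, and X
  -- itself, through the identity.
  example-fixes : 0ℚ ℚ.< b → 0ℚ ℚ.< j → ∀ N n {l} (S : Fin l → Fin (n ℕ.+ N)) (P : Matrix l (suc n)) →
    let A = λ i s → example N n i (S s) in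
    A *ᵐ P *ᵐ A ≈ᵐ A → ∀ s r → (A *ᵐ P) r (ρ N n (S s)) ≃ δ r (ρ N n (S s))
  example-fixes 0<b 0<j N n S P APA≈A s =
    projection-fixes (λ i s → example N n i (S s)) P APA≈A s (ρ N n (S s))
      (proj₂ (weight-inverse 0<b 0<j n (ρ N n (S s)))) (λ q → R.refl)

  -- Cauchy–Schwarz for the last row a of X_S and p = P e_last, using a · p = 1 and
  -- |a|² ≤ k b², in the form of the termwise estimate 2 μ a p - μ² b² ≤ p² with μ = 1 / (k b²).
  pseudoinverse-lower-bound : 0ℚ ℚ.< b → 0ℚ ℚ.< j → ∀ N n (S : Subset (n ℕ.+ N)) → n ℕ.< ∣ S ∣ →
    (P : Matrix ∣ S ∣ (suc n)) → IsPseudoInverse (columns (example N n) S) P →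
    ∀ {s} → BoundsOperator P s → ∀ {μ} → μ * (fromℕ ∣ S ∣ * (fromℚ b * fromℚ b)) ≃ 1ℝ →
    NonNeg (s ² - μ)
  pseudoinverse-lower-bound 0<b 0<j N n S n<∣S∣ P isP {s} bounds {μ} μkb²≃1 =
    NonNeg-resp-≃ combine (NonNeg-+
      (≤⇒NonNeg (bounds v))
      (NonNeg-sum-difference g (λ i → p i * p i) termwise))
    where
    A = columns (example N n) S
    last = Fin.fromℕ n
    v : Vector ℝ (suc n)
    v i = δ i last
    p a g : Vector ℝ ∣ S ∣
    p i = P i last
    a i = A last i
    c = μ * fromℚ b
    g i = (μ + μ) * (a i * p i) - c * c
    k = fromℕ ∣ S ∣
    hit = large-subset-meets-last N n S n<∣S∣
    -- The column found by `hit` is a nonzero multiple of the last unit vector, so `A *ᵐ P` fixes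
    -- that vector.
    a·p≃1 : sum (λ i → a i * p i) ≃ 1ℝ
    a·p≃1 = R.trans
      (subst (λ r → (A *ᵐ P) last r ≃ δ last r) (proj₂ hit)
        (example-fixes 0<b 0<j N n (elements S) P (IsPseudoInverse.APA≈A isP) (proj₁ hit) last))
      (R.reflexive (δ-refl last))
    termwise : ∀ i → NonNeg (p i * p i - g i)
    termwise i = young μ (fromℚ b) (p i) (Sum.map₂
      (λ (last≡ρ , δ≡1) →
        cong fromℚ (≡.trans (cong (weight n) (≡.sym last≡ρ)) (weight-last n)) , δ≡1)
      (δ-cases last (ρ N n (elements S i))))
    -- The chosen `μ` maximises 2 μ - μ² k b², and the maximum is `μ` itself.
    sum-g : sum g ≃ μ
    sum-g = begin
      sum g
        ≈⟨ ∑-distrib-+ (λ i → (μ + μ) * (a i * p i)) (λ _ → - (c * c)) ⟩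
      sum (λ i → (μ + μ) * (a i * p i)) + sum {∣ S ∣} (λ _ → - (c * c))
        ≈⟨ R.+-cong (*-sum (μ + μ) (λ i → a i * p i)) (R.sym (sum-const ∣ S ∣ (- (c * c)))) ⟨
      (μ + μ) * sum (λ i → a i * p i) + k * - (c * c)
        ≈⟨ R.+-congʳ (R.*-congˡ a·p≃1) ⟩
      (μ + μ) * 1ℝ + k * - (c * c)
        ≈⟨ solve 3 (λ l k b → (l :+ l) :* con 1ℚ :+ k :* (:- ((l :* b) :* (l :* b)))
                   := l :+ l :- l :* (l :* (k :* (b :* b)))) R.refl μ k (fromℚ b) ⟩
      μ + μ - μ * (μ * (k * (fromℚ b * fromℚ b)))
        ≈⟨ R.+-congˡ (R.-‿cong (R.*-congˡ μkb²≃1)) ⟩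
      μ + μ - μ * 1ℝ
        ≈⟨ solve 1 (λ l → l :+ l :- l :* con 1ℚ := l) R.refl μ ⟩
      μ ∎
    ‖v‖²≃1 : ‖ v ‖² ≃ 1ℝ
    ‖v‖²≃1 = R.trans (sum-δʳ v last) (R.reflexive (δ-refl last))
    ‖Pv‖²≃ : ‖ P *ᵛ v ‖² ≃ sum (λ i → p i * p i)
    ‖Pv‖²≃ = sum-cong λ i → R.*-cong (sum-δʳ (P i) last) (sum-δʳ (P i) last)
    combine : (s ² * ‖ v ‖² - ‖ P *ᵛ v ‖²) + (sum (λ i → p i * p i) - sum g) ≃ s ² - μ
    combine = begin
      (s ² * ‖ v ‖² - ‖ P *ᵛ v ‖²) + (sum (λ i → p i * p i) - sum g)
        ≈⟨ R.+-cong (R.+-cong (R.*-congˡ ‖v‖²≃1) (R.-‿cong ‖Pv‖²≃)) (R.+-congˡ (R.-‿cong sum-g)) ⟩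
      (s ² * 1ℝ - sum (λ i → p i * p i)) + (sum (λ i → p i * p i) - μ)
        ≈⟨ solve 3 (λ s q l → (s :* con 1ℚ :- q) :+ (q :- l) := s :- l) R.refl
             (s ²) (sum (λ i → p i * p i)) μ ⟩
      s ² - μ ∎

-- The upper bound for the pseudo-inverse of X.

module _ (b j : ℚ) where

  -- Entry t of Q v depends only on the row ρ t, say as z (ρ t). Hence ‖Q v‖² is the sum of f z²,
  -- with f the multiplicities, while X Q = 1 gives v = f w z. The claim c² (f w z)² ≥ f z² then
  -- holds termwise, because f w² ≥ j² and c j = 1.
  pseudoinverse-upper-bound : 0ℚ ℚ.< b → 0ℚ ℚ.< j → ∀ N n →
    j ℚ.* j ℚ.≤ cast (suc N) ℚ.* (b ℚ.* b) →
    (Q : Matrix (n ℕ.+ suc N) (suc n)) → IsPseudoInverse (example b j (suc N) n) Q →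
    ∀ {c} → c * fromℚ j ≃ 1ℝ → BoundsOperator Q c
  pseudoinverse-upper-bound 0<b 0<j N n j²≤Nb² Q isQ {c} cj≃1 v = NonNeg⇒≤
    (NonNeg-resp-≃
      (R.+-cong
        (R.trans (R.sym (*-sum (c ²) (λ r → (f r * (w r * z r)) ²)))
          (R.*-congˡ (sum-cong λ r → R.*-cong (fwz≃v r) (fwz≃v r))))
        (R.-‿cong (R.sym ‖Qv‖²≃)))
      (NonNeg-sum-difference (λ r → f r * z r ²) (λ r → c ² * (f r * (w r * z r)) ²) termwise))
    where
    open IsPseudoInverse isQ
    X = example b j (suc N) n
    ρ' = ρ (suc N) n
    f w z : Vector ℝ (suc n)
    H : Fin (suc n) → Vector ℝ (suc n)
    f r = fromℚ (cast (multiplicity (suc N) n r))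
    w r = fromℚ (weight b j n r)
    H r i = w r * sum (λ s → Q s r * Q s i)
    z r = sum (λ i → H r i * v i)
    -- Q = (Q X)ᵀ Q = Xᵀ Qᵀ Q, so row t of Q depends on ρ t only.
    Q≃H : ∀ t i → Q t i ≃ H (ρ' t) i
    Q≃H t i = begin
      Q t i
        ≈⟨ ≈⇒≃ (PAP≈P t i) ⟨
      sum (λ s → (Q *ᵐ X) t s * Q s i)
        ≈⟨ sum-cong (λ s → R.*-congʳ {Q s i} (≈⇒≃ (PA-sym t s))) ⟨
      sum (λ s → (Q *ᵐ X) s t * Q s i)
        ≈⟨ sum-cong (λ s → R.*-congʳ {Q s i} (QX s)) ⟩
      sum (λ s → w (ρ' t) * Q s (ρ' t) * Q s i)
        ≈⟨ sum-cong (λ s → R.*-assoc (w (ρ' t)) (Q s (ρ' t)) (Q s i)) ⟩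
      sum (λ s → w (ρ' t) * (Q s (ρ' t) * Q s i))
        ≈⟨ *-sum (w (ρ' t)) (λ s → Q s (ρ' t) * Q s i) ⟨
      H (ρ' t) i ∎
      where
      QX : ∀ s → (Q *ᵐ X) s t ≃ w (ρ' t) * Q s (ρ' t)
      QX s = begin
        sum (λ r → Q s r * (w (ρ' t) * δ r (ρ' t)))
          ≈⟨ sum-cong (λ r → solve 3 (λ q w d → q :* (w :* d) := (w :* q) :* d) R.refl
               (Q s r) (w (ρ' t)) (δ r (ρ' t))) ⟩
        sum (λ r → w (ρ' t) * Q s r * δ r (ρ' t))
          ≈⟨ sum-δʳ (λ r → w (ρ' t) * Q s r) (ρ' t) ⟩
        w (ρ' t) * Q s (ρ' t) ∎
    -- By `ι` every unit vector is, up to its weight, a column of X, so X Q fixes all of them.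
    XQ≃1 : ∀ r i → (X *ᵐ Q) r i ≃ δ r i
    XQ≃1 r i = subst (λ k → (X *ᵐ Q) r k ≃ δ r k) (ρ-ι N n i)
      (example-fixes b j 0<b 0<j (suc N) n (λ t → t) Q APA≈A (ι N n i) r)
    fwH≃δ : ∀ r i → f r * (w r * H r i) ≃ δ r i
    fwH≃δ r i = begin
      f r * (w r * H r i)                 ≈⟨ sum-example b j (suc N) n r (λ k → H k i) ⟨
      sum (λ t → X r t * H (ρ' t) i)      ≈⟨ sum-cong (λ t → R.*-congˡ (Q≃H t i)) ⟨
      sum (λ t → X r t * Q t i)           ≈⟨ XQ≃1 r i ⟩
      δ r i                               ∎
    fwz≃v : ∀ r → f r * (w r * z r) ≃ v r
    fwz≃v r = begin
      f r * (w r * z r)                            ≈⟨ R.*-assoc (f r) (w r) (z r) ⟨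
      f r * w r * z r                              ≈⟨ *-sum (f r * w r) (λ i → H r i * v i) ⟩
      sum (λ i → f r * w r * (H r i * v i))        ≈⟨ sum-cong (λ i → regroup (H r i) (v i)) ⟩
      sum (λ i → f r * (w r * H r i) * v i)        ≈⟨ sum-cong (λ i → R.*-congʳ {v i} (fwH≃δ r i)) ⟩
      sum (λ i → δ r i * v i)                      ≈⟨ sum-δ r v ⟩
      v r                                          ∎
      where
      regroup : ∀ h v → f r * w r * (h * v) ≃ f r * (w r * h) * v
      regroup = solve 4 (λ f w h v → f :* w :* (h :* v) := f :* (w :* h) :* v) R.refl (f r) (w r)
    ‖Qv‖²≃ : ‖ Q *ᵛ v ‖² ≃ sum (λ r → f r * z r ²)
    ‖Qv‖²≃ = R.trans
      (sum-cong λ t → R.*-cong (Qv≃z t) (Qv≃z t))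
      (sum-ρ (suc N) n (λ r → z r ²))
      where
      Qv≃z : ∀ t → (Q *ᵛ v) t ≃ z (ρ' t)
      Qv≃z t = sum-cong λ i → R.*-congʳ {v i} (Q≃H t i)
    fw²-j² : ∀ r → NonNeg (f r * (w r * w r) - fromℚ j * fromℚ j)
    fw²-j² r = NonNeg-resp-≃
      (R.trans (fromℚ-+ _ _) (R.+-cong
        (R.trans (fromℚ-* _ _) (R.*-congˡ (fromℚ-* _ _)))
        (R.trans (fromℚ-neg _) (R.-‿cong (fromℚ-* j j)))))
      (NonNeg-fromℚ (≤⇒0≤ (j²≤multiplicity*weight² b j (suc N) j²≤Nb² n r)))
    termwise : ∀ r → NonNeg (c ² * (f r * (w r * z r)) ² - f r * z r ²)
    termwise r = NonNeg-resp-≃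
      (begin
        f r * (c * c * (z r * z r)) * (f r * (w r * w r) - fromℚ j * fromℚ j)
          ≈⟨ solve 5 (λ f w z c j → f :* (c :* c :* (z :* z)) :* (f :* (w :* w) :- j :* j)
               := c :* c :* (f :* (w :* z) :* (f :* (w :* z))) :- (c :* j) :* (c :* j) :* (f :* (z :* z)))
               R.refl
               (f r) (w r) (z r) c (fromℚ j) ⟩
        c ² * (f r * (w r * z r)) ² - c * fromℚ j * (c * fromℚ j) * (f r * z r ²)
          ≈⟨ R.+-congˡ (R.-‿cong (R.*-congʳ (R.*-cong cj≃1 cj≃1))) ⟩
        c ² * (f r * (w r * z r)) ² - 1ℝ * 1ℝ * (f r * z r ²)
          ≈⟨ R.+-congˡ (R.-‿cong (solve 1 (λ x → con 1ℚ :* con 1ℚ :* x := x) R.refl (f r * z r ²))) ⟩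
        c ² * (f r * (w r * z r)) ² - f r * z r ² ∎)
      (NonNeg-* (NonNeg-* (NonNeg-fromℚ (0≤cast (multiplicity (suc N) n r)))
        (NonNeg-* (NonNeg-² c) (NonNeg-² (z r)))) (fw²-j² r))

-- Combination of the two bounds.

-- With κ r = 1 for κ = k + α², μ k b² = 1 and c j = 1, the difference of the two sides is
-- μ (j² (c - t) (c + t) + (j² - b² e) t² + b² e r α² t²).
certificate : ∀ (α k e m b j μ c s t : ℝ) (κ>0 : 0ℝ < k + α ²) →
  m ≃ k + e → NonNeg e → NonNeg μ → NonNeg c → NonNeg t →
  μ * (k * (b * b)) ≃ 1ℝ → c * j ≃ 1ℝ → NonNeg (j * j - b * b * e) →
  NonNeg (s ² - μ) → NonNeg (c - t) →
  s ² ≥ ((m + α ²) / (k + α ²) [ κ>0 ] - 1ℝ) * t ²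
certificate α k e m b j μ c s t κ>0 m≃k+e 0≤e 0≤μ 0≤c 0≤t μkb²≃1 cj≃1 b²e≤j² μ≤s² t≤c =
  NonNeg⇒≤ (NonNeg-resp-≃ combine (NonNeg-+ μ≤s² (NonNeg-* 0≤μ (NonNeg-+ (NonNeg-+
    (NonNeg-* (NonNeg-² j) (NonNeg-* t≤c (NonNeg-+ 0≤c 0≤t)))
    (NonNeg-* b²e≤j² (NonNeg-² t)))
    (NonNeg-* (NonNeg-* (NonNeg-* (NonNeg-² b) 0≤e)
        (NonNeg-* (NonNeg-recip (k + α ²) κ>0) (NonNeg-² α)))
      (NonNeg-² t))))))
  where
  κ = k + α ²
  r = recip κ κ>0
  κr≃1 : κ * r ≃ 1ℝ
  κr≃1 = *-recip κ κ>0
  combine : (s ² - μ) + μ * (j * j * ((c - t) * (c + t)) + (j * j - b * b * e) * (t * t)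
              + b * b * e * (r * (α * α)) * (t * t)) ≃ s ² - ((m + α ²) * r - 1ℝ) * t ²
  combine = begin
    (s ² - μ) + μ * (j * j * ((c - t) * (c + t)) + (j * j - b * b * e) * (t * t)
      + b * b * e * (r * (α * α)) * (t * t))
      -- The new form isolates `c * j`, `κ * r` and `μ * (k * (b * b))`, which are all replaced by 1
      -- next.
      ≈⟨ solve 10 (λ α k e b j l c s t r →
           (s :* s :- l) :+ l :* (j :* j :* ((c :- t) :* (c :+ t))
             :+ (j :* j :- b :* b :* e) :* (t :* t) :+ b :* b :* e :* (r :* (α :* α)) :* (t :* t))
           := s :* s :- l :+ l :* ((c :* j) :* (c :* j)) :- l :* (b :* b) :* e :* (t :* t)
             :+ l :* (b :* b) :* e :* (t :* t) :* ((k :+ α :* α) :* r)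
             :- l :* (k :* (b :* b)) :* (e :* r :* (t :* t))) R.refl
           α k e b j μ c s t r ⟩
    s ² - μ + μ * (c * j * (c * j)) - μ * (b * b) * e * (t * t)
      + μ * (b * b) * e * (t * t) * (κ * r) - μ * (k * (b * b)) * (e * r * (t * t))
      ≈⟨ R.+-cong (R.+-cong (R.+-congʳ (R.+-congˡ (R.*-congˡ (R.*-cong cj≃1 cj≃1)))) (R.*-congˡ κr≃1))
           (R.-‿cong (R.*-congʳ μkb²≃1)) ⟩
    s ² - μ + μ * (1ℝ * 1ℝ) - μ * (b * b) * e * (t * t)
      + μ * (b * b) * e * (t * t) * 1ℝ - 1ℝ * (e * r * (t * t))
      ≈⟨ solve 6 (λ s l b e t r →
           s :* s :- l :+ l :* (con 1ℚ :* con 1ℚ) :- l :* (b :* b) :* e :* (t :* t)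
             :+ l :* (b :* b) :* e :* (t :* t) :* con 1ℚ :- con 1ℚ :* (e :* r :* (t :* t))
           := s :* s :- (con 1ℚ :+ e :* r :- con 1ℚ) :* (t :* t)) R.refl s μ b e t r ⟩
    s ² - (1ℝ + e * r - 1ℝ) * t ²
      -- A 1 is turned back into `κ * r`, so that `κ + e`, which is m + α², can be collected over
      -- the factor `r`.
      ≈⟨ R.+-congˡ (R.-‿cong (R.*-congʳ (R.+-congʳ (R.+-congʳ κr≃1)))) ⟨
    s ² - (κ * r + e * r - 1ℝ) * t ²
      ≈⟨ solve 6 (λ s t k a e r → s :- ((k :+ a) :* r :+ e :* r :- con 1ℚ) :* t
           := s :- ((k :+ e :+ a) :* r :- con 1ℚ) :* t) R.refl (s ²) (t ²) k (α ²) e r ⟩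
    s ² - ((k + e + α ²) * r - 1ℝ) * t ²
      ≈⟨ R.+-congˡ (R.-‿cong (R.*-congʳ (R.+-congʳ (R.*-congʳ (R.+-congʳ m≃k+e))))) ⟨
    s ² - ((m + α ²) * r - 1ℝ) * t ² ∎

-- Choice of the parameters of X.

fromℕ-+ : ∀ a b → fromℕ (a ℕ.+ b) ≃ fromℕ a + fromℕ b
fromℕ-+ a b = R.trans (≃-reflexive (cong fromℚ (cast-+ a b))) (fromℚ-+ (cast a) (cast b))

-- With `suc n` rows, `suc o` is d = m - (n + 1), and b and j are `suc b'` and `suc j'`. Matching
-- the equation for `m` with `refl` gives X its n + (d + 1) columns without transport.
theorem4p3-from-square : (α : ℝ) (α>0 : 0ℝ < α) (n o m k b' j' : ℕ) → n ℕ.+ suc (suc o) ≡ m →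
  suc o ℕ.* (suc b' ℕ.* suc b') ℕ.≤ suc j' ℕ.* suc j' →
  suc j' ℕ.* suc j' ℕ.≤ suc (suc o) ℕ.* (suc b' ℕ.* suc b') →
  suc n ℕ.≤ k → k ℕ.≤ m →
  Σ (Matrix (suc n) m) λ X → FullRank X ×
  ((S : Subset m) → ∣ S ∣ ≡ k → HasRank (columns X S) (suc n) →
  (P : Matrix ∣ S ∣ (suc n)) → IsPseudoInverse (columns X S) P →
  (s : ℝ) → IsSpectralNorm P s →
  (Q : Matrix m (suc n)) → IsPseudoInverse X Q →
  (t : ℝ) → IsSpectralNorm Q t →
  s ² ≥ ((fromℕ m + α ²) / (fromℕ k + α ²) [ ℕ+²-positive k α>0 ] - 1ℝ) * t ²)
theorem4p3-from-square α α>0 n o _ k b' j' refl ob²≤j² j²≤ob² n<k k≤m =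
  X , subst (HasRank X) (≡.sym (ℕ.m≤n⇒m⊓n≡m n<M)) (example-hasRank b j 0<b 0<j (suc o) n) , bound
  where
  M = n ℕ.+ suc (suc o)
  b j : ℚ
  b = cast (suc b')
  j = cast (suc j')
  0<b = 0<cast b'
  0<j = 0<cast j'
  X = example b j (suc (suc o)) n
  M≡ : M ≡ suc n ℕ.+ suc o
  M≡ = ℕ.+-suc n (suc o)
  n<M : suc n ℕ.≤ M
  n<M = ℕ.≤-trans (ℕ.m≤m+n (suc n) (suc o)) (ℕ.≤-reflexive (≡.sym M≡))
  e = M ℕ.∸ k
  k+e≡M : k ℕ.+ e ≡ M
  k+e≡M = ℕ.m+[n∸m]≡n k≤m
  -- Since k ≥ n + 1, at most d columns are left out; hence b² e ≤ d b² ≤ j².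
  e≤o : e ℕ.≤ suc o
  e≤o = ℕ.+-cancelˡ-≤ (suc n) e (suc o) (ℕ.≤-trans (ℕ.+-monoˡ-≤ e n<k)
    (ℕ.≤-reflexive (≡.trans k+e≡M M≡)))
  j²≤Nb² : j ℚ.* j ℚ.≤ cast (suc (suc o)) ℚ.* (b ℚ.* b)
  j²≤Nb² = subst₂ ℚ._≤_ (cast-* (suc j') (suc j'))
    (≡.trans (cast-* (suc (suc o)) (suc b' ℕ.* suc b'))
      (cong (cast (suc (suc o)) ℚ.*_) (cast-* (suc b') (suc b'))))
    (cast-mono j²≤ob²)
  b²e≤j² : b ℚ.* b ℚ.* cast e ℚ.≤ j ℚ.* j
  b²e≤j² = subst₂ ℚ._≤_
    (≡.trans (cast-* (suc b' ℕ.* suc b') e) (cong (ℚ._* cast e) (cast-* (suc b') (suc b'))))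
    (cast-* (suc j') (suc j'))
    (cast-mono (ℕ.≤-trans
      (ℕ.≤-trans (ℕ.*-monoʳ-≤ (suc b' ℕ.* suc b') e≤o)
        (ℕ.≤-reflexive (ℕ.*-comm (suc b' ℕ.* suc b') (suc o))))
      ob²≤j²))
  0<k : 0ℚ ℚ.< cast k
  0<k = ℚ.<-≤-trans (0<cast n) (cast-mono n<k)
  μ-inverse = inverse (cast k ℚ.* (b ℚ.* b)) (0<* 0<k (0<* 0<b 0<b))
  c-inverse = inverse j 0<j
  μ c : ℝ
  μ = fromℚ (proj₁ μ-inverse)
  c  = fromℚ (proj₁ c-inverse)
  μkb²≃1 : μ * (fromℕ k * (fromℚ b * fromℚ b)) ≃ 1ℝ
  μkb²≃1 = R.trans
    (R.sym (R.trans (fromℚ-* _ _) (R.*-congˡ (R.trans (fromℚ-* _ _) (R.*-congˡ (fromℚ-* b b))))))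
    (≃-reflexive (cong fromℚ (proj₂ (proj₂ μ-inverse))))
  cj≃1 : c * fromℚ j ≃ 1ℝ
  cj≃1 = R.trans (R.sym (fromℚ-* (proj₁ c-inverse) j))
    (≃-reflexive (cong fromℚ (proj₂ (proj₂ c-inverse))))
  0≤c : NonNeg c
  0≤c = NonNeg-fromℚ (ℚ.<⇒≤ (proj₁ (proj₂ c-inverse)))
  bound : (S : Subset M) → ∣ S ∣ ≡ k → HasRank (columns X S) (suc n) →
    (P : Matrix ∣ S ∣ (suc n)) → IsPseudoInverse (columns X S) P →
    (s : ℝ) → IsSpectralNorm P s →
    (Q : Matrix M (suc n)) → IsPseudoInverse X Q →
    (t : ℝ) → IsSpectralNorm Q t →
    s ² ≥ ((fromℕ M + α ²) / (fromℕ k + α ²) [ ℕ+²-positive k α>0 ] - 1ℝ) * t ²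
  bound S ∣S∣≡k _ P isP s s-norm Q isQ t t-norm =
    certificate α (fromℕ k) (fromℕ e) (fromℕ M) (fromℚ b) (fromℚ j) μ c s t (ℕ+²-positive k α>0)
      (R.trans (≃-reflexive (cong fromℕ (≡.sym k+e≡M))) (fromℕ-+ k e))
      (NonNeg-fromℚ (0≤cast e)) (NonNeg-fromℚ (ℚ.<⇒≤ (proj₁ (proj₂ μ-inverse)))) 0≤c
      (NonNeg-resp-≃ (solve 1 (λ t → t :- con 0ℚ := t) R.refl t)
        (≤⇒NonNeg (IsSpectralNorm.nonNeg t-norm)))
      μkb²≃1 cj≃1
      (NonNeg-resp-≃
        (R.trans (fromℚ-+ _ _) (R.+-cong (fromℚ-* j j)
          (R.trans (fromℚ-neg _) (R.-‿cong (R.trans (fromℚ-* _ _) (R.*-congʳ (fromℚ-* b b)))))))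
        (NonNeg-fromℚ (≤⇒0≤ b²e≤j²)))
      (pseudoinverse-lower-bound b j 0<b 0<j (suc (suc o)) n S (subst (n ℕ.<_) (≡.sym ∣S∣≡k) n<k)
        P isP
        (IsSpectralNorm.bounds s-norm)
        (subst (λ k → μ * (fromℕ k * (fromℚ b * fromℚ b)) ≃ 1ℝ) (≡.sym ∣S∣≡k) μkb²≃1))
      -- `c` = 1 / j bounds the operator `Q`, and the norm `t` is the least such bound.
      (≤⇒NonNeg (IsSpectralNorm.least t-norm c
        (NonNeg⇒≤ (NonNeg-resp-≃ (solve 1 (λ c → c := c :- con 0ℚ) R.refl c) 0≤c))
        (pseudoinverse-upper-bound b j 0<b 0<j (suc o) n j²≤Nb² Q isQ cj≃1)))

-- Strictness makes d = m - (n + 1) positive, so it has the form `suc o` for which `square-between`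
-- supplies b and j.
split-columns : ∀ {n m} → suc n ℕ.< m → ∃ λ o → n ℕ.+ suc (suc o) ≡ m
split-columns {n} n<m with o , refl ← ℕ.m≤n⇒∃[o]m+o≡n n<m =
  o , ≡.trans (ℕ.+-suc n (suc o)) (cong suc (ℕ.+-suc n o))

theorem4p3 : (α : ℝ) (α>0 : 0ℝ < α) (n m k : ℕ) →
    n ℕ.> 0 → m ℕ.> 2 → m ℕ.> n → n ℕ.≤ k → k ℕ.≤ m →
    Σ (Matrix n m) λ X → FullRank X ×
    ((S : Subset m) → ∣ S ∣ ≡ k → HasRank (columns X S) n →
    (P : Matrix ∣ S ∣ n) → IsPseudoInverse (columns X S) P →
    (s : ℝ) → IsSpectralNorm P s →
    (Q : Matrix m n) → IsPseudoInverse X Q →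
    (t : ℝ) → IsSpectralNorm Q t →
    s ² ≥ ((fromℕ m + α ²) / (fromℕ k + α ²) [ ℕ+²-positive k α>0 ] - 1ℝ) * t ²)
theorem4p3 α α>0 (suc n) m k _ _ n<m n<k k≤m =
  let o , n+2+o≡m = split-columns n<m
      b' , j' , ob²≤j² , j²≤ob² = square-between o
  in theorem4p3-from-square α α>0 n o m k b' j' n+2+o≡m ob²≤j² j²≤ob² n<k k≤m
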